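{- Let $n\ge1$, $k\ge1$ and $\pi=v_1^{c_1}\cdots v_n^{c_n}\in\mathbf{C}(n,k)$. Consider the procedure: set $\mathit{incr}=0$; for $j=1,2,\dots,n-1$ in turn: (i) if $v_j<v_{j+1}$, increase $\mathit{incr}$ by $1$; (ii) if $\mathit{incr}=2$, or $\mathit{incr}=1$ and $v_{j+1}<v_1$, return $\mathrm{flip}_j(\pi)$; (iii) if $k>1$, $v_j<v_{j+1}$ and $(c_{j+1}-c_j)\bmod k\neq1$, return $\mathrm{flip}_j(\pi)$; (iv) if $k>1$, $v_j>v_{j+1}$ and $c_j\ne c_{j+1}$, return $\mathrm{flip}_j(\pi)$. If the loop finishes without returning, return $\mathrm{flip}_n(\pi)$. Then the procedure returns the successor of $\pi$ in the cyclic list $\mathcal{C}(1^02^0\cdots n^0)$ (the successor of the last entry being the first), and it determines the required flip length using $O(n)$ operations.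
   Context: A $k$-coloured permutation of $\{1,\dots,n\}$ is a sequence $\pi=p_1\cdots p_n$ with $p_i=v_i^{c_i}$, where $v_1\cdots v_n$ is a permutation of $\{1,\dots,n\}$ and each $c_i\in\{0,\dots,k-1\}$; the set of these is $\mathbf{C}(n,k)$. A pre-perm is a prefix $p_1\cdots p_j$ ($1\le j\le n$) of some element of $\mathbf{C}(n,k)$. For $p=v^c$ and integer $s$, $p^{+s}=v^{(c+s)\bmod k}$; for $\mathbf{p}=p_1\cdots p_j$, $\mathbf{p}^{+s}=p_1^{+s}\cdots p_j^{+s}$. For $1\le i\le n$, $\mathrm{flip}_i(p_1\cdots p_n)=p_i^{+1}\cdots p_1^{+1}p_{i+1}\cdots p_n$. For a pre-perm $\mathbf{p}$ of length $j$, $\rho(\mathbf{p})=r_1\cdots r_m$ ($m=kj$) is the concatenation $\mathbf{p}^{+(k-1)}\mathbf{p}^{+(k-2)}\cdots\mathbf{p}^{+0}$ viewed circularly (indices mod $m$), and $\rho(\mathbf{p})_i=r_{i-j+1}\cdots r_{i-1}$ (length $j-1$, indices mod $m$). The list $\mathcal{C}(\mathbf{p})$: if $j=1$, $\mathcal{C}(p_1)=p_1^{+0},\dots,p_1^{+(k-1)}$; if $j\ge2$, $\mathcal{C}(\mathbf{p})$ is the concatenation for $i=m,m-1,\dots,1$ of the lists obtained from $\mathcal{C}(\rho(\mathbf{p})_i)$ by appending $r_i$ to every entry. -}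

module Defs where

open import Data.Bool.Base using (Bool; true; false; not; _∧_; _∨_)
open import Data.Fin.Base using (Fin; zero; suc; toℕ; fromℕ; fromℕ<; inject₁; opposite)
open import Data.Fin.Permutation using (Permutation′; _⟨$⟩ʳ_)
open import Data.Fin.Properties using (toℕ<n)
open import Data.Integer.Base as ℤ using (ℤ; +_)
open import Data.Integer.DivMod using (n%ℕd<d)
open import Data.List.Base as List using (List; concatMap; downFrom; upTo; allFin)
open import Data.Nat.Base using (ℕ; zero; suc; _+_; _*_; _∸_; NonZero; _<ᵇ_; _≡ᵇ_)
open import Data.Nat.DivMod using (_mod_)
open import Data.Nat.Properties using (m*n≢0; m+[n∸m]≡n)
open import Data.Product.Base using (Σ; _×_; _,_; proj₁; proj₂)
open import Data.Vec.Base as Vec using (Vec; []; _∷_; _++_; _∷ʳ_; tabulate; lookup; concat; take; drop; reverse; cast)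
open import Relation.Binary.PropositionalEquality.Core using (_≡_; sym)

-- Values and positions in {1,…,n} are represented by Fin n, the number v
-- being the element i with toℕ i ≡ v - 1.

infix 8 _^^_

record Letter (n k : ℕ) : Set where
  constructor _^^_
  field
    value  : Fin n
    colour : Fin k

open Letter public

Word : (n k j : ℕ) → Set
Word n k j = Vec (Letter n k) j

record ColouredPermutation (n k : ℕ) : Set where
  field
    values  : Permutation′ n
    colours : Fin n → Fin k

  word : Word n k n
  word = tabulate (λ i → (values ⟨$⟩ʳ i) ^^ colours i)

open ColouredPermutation public

module _ {n k : ℕ} .⦃ _ : NonZero k ⦄ where

  infixl 9 _⁺_ _⁺⁺_

  _⁺_ : Letter n k → ℕ → Letter n k
  (v ^^ c) ⁺ s = v ^^ ((toℕ c + s) mod k)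

  _⁺⁺_ : ∀ {j} → Word n k j → ℕ → Word n k j
  p ⁺⁺ s = Vec.map (_⁺ s) p

  -- The flip of the prefix that ends at position i, i.e. of length toℕ i + 1.
  flip : ∀ {j} → Fin j → Word n k j → Word n k j
  flip {j} i p = cast eq (reverse (take ℓ p′ ⁺⁺ 1) ++ drop ℓ p′)
    where
    ℓ : ℕ
    ℓ = suc (toℕ i)

    eq : ℓ + (j ∸ ℓ) ≡ j
    eq = m+[n∸m]≡n (toℕ<n i)

    p′ : Word n k (ℓ + (j ∸ ℓ))
    p′ = cast (sym eq) p

  ρ : ∀ {j} → Word n k j → Word n k (k * j)
  ρ p = concat (tabulate {n = k} (λ a → p ⁺⁺ toℕ (opposite a)))

  -- r p i is the letter r_i of ρ(p), for an arbitrary integer i: the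
  -- indices are 1-based and read modulo the length of ρ(p).
  r : ∀ {j} → Word n k (suc j) → ℤ → Letter n k
  r {j} p i = lookup (ρ p) (fromℕ< (n%ℕd<d (i ℤ.- + 1) (k * suc j)))
    where instance _ = m*n≢0 k (suc j)

  -- ρ(p)_i for p of length suc j, so that its first index is i - j.
  ρAt : ∀ {j} → Word n k (suc j) → ℤ → Word n k j
  ρAt {j} p i = tabulate (λ t → r p (i ℤ.- + j ℤ.+ + toℕ t))

  -- The recursion makes sense for all nonempty words; applied to a pre-perm it
  -- only visits pre-perms.
  𝒞 : ∀ {j} → Word n k (suc j) → List (Word n k (suc j))
  𝒞 {zero}  p = List.map (p ⁺⁺_) (upTo k)
  𝒞 {suc j} p = concatMap block (List.map suc (downFrom (k * suc (suc j))))
    where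
    block : ℕ → List (Word n k (suc (suc j)))
    block i = List.map (_∷ʳ r p (+ i)) (𝒞 (ρAt p (+ i)))

identityWord : (n k : ℕ) .⦃ _ : NonZero k ⦄ → Word n k n
identityWord n k = tabulate (λ i → i ^^ (0 mod k))

cyclicSuc : ∀ {m} → Fin m → Fin m
cyclicSuc {suc m} i = suc (toℕ i) mod suc m

-- "y is the successor of x in the cyclic list xs"; the definite article
-- is read as including that x occurs exactly once.
IsCyclicSuccessor : {A : Set} → List A → A → A → Set
IsCyclicSuccessor xs x y =
  Σ (Fin (List.length xs)) λ i →
    List.lookup xs i ≡ x ×
    (∀ i′ → List.lookup xs i′ ≡ x → i′ ≡ i) ×
    List.lookup xs (cyclicSuc i) ≡ y

-- The procedure is given as a piece of syntax, whose semantics yields both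
-- the result and the number of elementary operations (unit-cost model).  The
-- syntax does not depend on n, k or the input.

data Type : Set where
  position natural integer boolean : Type

infix  9 v[_] c[_]
infixl 8 _mod-k
infixl 7 _⊕_ _⊝_
infix  6 _<′_ _≡′_
infix  5 ¬′_
infixr 4 _∧′_
infixr 3 _∨′_

data Exp : Type → Set where
  pos-1 pos-j pos-j+1 : Exp position
  lit                 : ℕ → Exp natural
  k′ incr             : Exp natural
  v[_] c[_]           : Exp position → Exp natural
  _⊕_                 : Exp natural → Exp natural → Exp natural
  _⊝_                 : Exp natural → Exp natural → Exp integer
  _mod-k              : Exp integer → Exp natural
  _<′_ _≡′_           : Exp natural → Exp natural → Exp boolean
  ¬′_                 : Exp boolean → Exp boolean
  _∧′_ _∨′_           : Exp boolean → Exp boolean → Exp boolean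

infix  2 incr≔_ return_ if_then_
infixr 1 _⨾_

data Stmt : Set where
  incr≔_   : Exp natural → Stmt
  return_  : Exp position → Stmt
  if_then_ : Exp boolean → Stmt → Stmt
  _⨾_      : Stmt → Stmt → Stmt

-- Every node of an expression is one operation; ∧′ and ∨′ do not short-circuit.
expCost : ∀ {t} → Exp t → ℕ
expCost pos-1     = 1
expCost pos-j     = 1
expCost pos-j+1   = 1
expCost (lit _)   = 1
expCost k′        = 1
expCost incr      = 1
expCost v[ e ]    = 1 + expCost e
expCost c[ e ]    = 1 + expCost e
expCost (d ⊕ e)   = 1 + expCost d + expCost e
expCost (d ⊝ e)   = 1 + expCost d + expCost e
expCost (e mod-k) = 1 + expCost e
expCost (d <′ e)  = 1 + expCost d + expCost e
expCost (d ≡′ e)  = 1 + expCost d + expCost e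
expCost (¬′ e)    = 1 + expCost e
expCost (d ∧′ e)  = 1 + expCost d + expCost e
expCost (d ∨′ e)  = 1 + expCost d + expCost e

-- Inputs have length suc n, so the loop index j ∈ {1,…,(suc n) - 1} is an
-- element of Fin n, with j and j + 1 as positions being inject₁ j and suc j.

data Outcome (n : ℕ) : Set where
  continue : (incr : ℕ) → Outcome n
  returned : (lastPosition : Fin (suc n)) → Outcome n

module Semantics {n k : ℕ} .⦃ _ : NonZero k ⦄ (π : Word (suc n) k (suc n)) where

  Value : Type → Set
  Value position = Fin (suc n)
  Value natural  = ℕ
  Value integer  = ℤ
  Value boolean  = Bool

  ⟦_⟧ : ∀ {t} → Exp t → (j : Fin n) (incr : ℕ) → Value t
  ⟦ pos-1 ⟧   j x = zero
  ⟦ pos-j ⟧   j x = inject₁ j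
  ⟦ pos-j+1 ⟧ j x = suc j
  ⟦ lit a ⟧   j x = a
  ⟦ k′ ⟧      j x = k
  ⟦ incr ⟧    j x = x
  ⟦ v[ e ] ⟧  j x = suc (toℕ (value (lookup π (⟦ e ⟧ j x))))
  ⟦ c[ e ] ⟧  j x = toℕ (colour (lookup π (⟦ e ⟧ j x)))
  ⟦ d ⊕ e ⟧   j x = ⟦ d ⟧ j x + ⟦ e ⟧ j x
  ⟦ d ⊝ e ⟧   j x = + ⟦ d ⟧ j x ℤ.- + ⟦ e ⟧ j x
  ⟦ e mod-k ⟧ j x = ⟦ e ⟧ j x ℤ.%ℕ k
  ⟦ d <′ e ⟧  j x = ⟦ d ⟧ j x <ᵇ ⟦ e ⟧ j x
  ⟦ d ≡′ e ⟧  j x = ⟦ d ⟧ j x ≡ᵇ ⟦ e ⟧ j x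
  ⟦ ¬′ e ⟧    j x = not (⟦ e ⟧ j x)
  ⟦ d ∧′ e ⟧  j x = ⟦ d ⟧ j x ∧ ⟦ e ⟧ j x
  ⟦ d ∨′ e ⟧  j x = ⟦ d ⟧ j x ∨ ⟦ e ⟧ j x

  charge : {A : Set} → ℕ → A × ℕ → A × ℕ
  charge a (o , b) = o , a + b

  exec : Stmt → (j : Fin n) (incr : ℕ) → Outcome n × ℕ
  exec (incr≔ e) j x = continue (⟦ e ⟧ j x) , 1 + expCost e
  exec (return e) j x = returned (⟦ e ⟧ j x) , 1 + expCost e
  exec (if e then s) j x with ⟦ e ⟧ j x
  ... | true  = charge (1 + expCost e) (exec s j x)
  ... | false = continue x , 1 + expCost e
  exec (s ⨾ s′) j x with exec s j x
  ... | continue x′ , a = charge a (exec s′ j x′)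
  ... | returned i  , a = returned i , a

  -- Loop control costs two operations (test and advance j) per iteration.  A
  -- loop that runs to completion returns the full length, at the cost of a
  -- final test, reading the length and the return.
  execFor : List (Fin n) → Stmt → (incr : ℕ) → Fin (suc n) × ℕ
  execFor List.[]       s x = fromℕ n , 3
  execFor (j List.∷ js) s x with exec s j x
  ... | continue x′ , a = charge (2 + a) (execFor js s x′)
  ... | returned i  , a = i , 2 + a

  -- incr := 0, then the loop.
  run : Stmt → Fin (suc n) × ℕ
  run s = charge 2 (execFor (allFin n) s 0)

loopBody : Stmt
loopBody =
  (if v[ pos-j ] <′ v[ pos-j+1 ]
    then (incr≔ incr ⊕ lit 1)) ⨾
  (if incr ≡′ lit 2 ∨′ (incr ≡′ lit 1 ∧′ v[ pos-j+1 ] <′ v[ pos-1 ])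
    then (return pos-j)) ⨾
  (if lit 1 <′ k′ ∧′ v[ pos-j ] <′ v[ pos-j+1 ] ∧′ ¬′ ((c[ pos-j+1 ] ⊝ c[ pos-j ]) mod-k ≡′ lit 1)
    then (return pos-j)) ⨾
  (if lit 1 <′ k′ ∧′ v[ pos-j+1 ] <′ v[ pos-j ] ∧′ ¬′ (c[ pos-j ] ≡′ c[ pos-j+1 ])
    then (return pos-j))

module _ {n k : ℕ} .⦃ _ : NonZero k ⦄ (π : ColouredPermutation (suc n) k) where

  -- The last position of the prefix to be flipped; the length is one more.
  flipPosition : Fin (suc n)
  flipPosition = proj₁ (Semantics.run (word π) loopBody)

  operationCount : ℕ
  operationCount = proj₂ (Semantics.run (word π) loopBody)

  procedure : Word (suc n) k (suc n)
  procedure = flip flipPosition (word π)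

{-# OPTIONS --safe #-}

-- Read backwards, the circular word ρ(1⁰⋯n⁰) starts n⁰ ⋯ 1⁰ n¹ ⋯ 1¹ ⋯.  Call
-- a word Descending if its letters are met in order within less than one
-- period of this reading.  The block of 𝒞(p) that ends in r_{i-1} follows the
-- one that ends in r_i, and on reversed words this step is the rotation
-- x q ↦ q x⁺¹; the reversal of p always stays Descending.  By induction 𝒞(p)
-- starts with p, ends with the word whose flip is p, and the step from one
-- block to the next is a full flip.  So the successor of w flips the shortest
-- prefix that is not the last entry of its own sublist (or all of w), and a
-- proper prefix of length j is the last entry of its sublist exactly if the
-- prefix of length j + 1 is Descending.  The flipped prefix is therefore the
-- longest Descending one, and the loop extends a Descending prefix letter by
-- letter: at any time incr is 1 if v_j > v_1 and 0 otherwise.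
module Submission where

open import Data.Bool.Base using (Bool; true; false; if_then_else_; not; _∧_; _∨_)
open import Data.Bool.Properties using (∨-identityʳ; ∧-zeroʳ)
open import Data.Fin.Base as Fin using (Fin; zero; suc; toℕ)
open import Data.Fin.Permutation as Perm using (_⟨$⟩ʳ_; _⟨$⟩ˡ_)
import Data.Fin.Properties as Fin
open import Data.Integer.Base as ℤ using (+_; -[1+_])
import Data.Integer.Properties as ℤ
import Data.Integer.Tactic.RingSolver as ℤ
open import Data.List.Base using (List; []; _∷_; _++_; _∷ʳ_; [_]; map; reverse; length; concatMap; lookup; tabulate; allFin; applyUpTo; applyDownFrom; upTo; downFrom)
open import Data.List.Membership.Propositional using (_∈_; _∉_)
open import Data.List.Membership.Propositional.Properties using (∈-++⁻; ∈-map⁺; ∈-map⁻; ∈-lookup; ∈-tabulate⁺)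
open import Data.List.Membership.Propositional.Properties.WithK using (unique∧set⇒bag)
import Data.List.Properties as List
open import Data.List.Relation.Binary.BagAndSetEquality using (∼bag⇒↭)
open import Data.List.Relation.Binary.Permutation.Propositional using (_↭_; ↭-refl; ↭-reflexive; ↭-sym; ↭-trans)
open import Data.List.Relation.Binary.Permutation.Propositional.Properties using (All-resp-↭; ∈-resp-↭; drop-∷; ↭-empty-inv; ∷↭∷ʳ; ↭-reverse)
open import Data.List.Relation.Unary.All as All using (All; []; _∷_)
import Data.List.Relation.Unary.All.Properties as All
open import Data.List.Relation.Unary.AllPairs as AllPairs using (AllPairs; []; _∷_)
import Data.List.Relation.Unary.AllPairs.Properties as AllPairs
open import Data.List.Relation.Unary.Any using (here; there)
open import Data.List.Relation.Unary.Unique.Propositional using (Unique)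
open import Data.Nat.Base using (ℕ; zero; suc; pred; _+_; _*_; _∸_; _<_; _≤_; _<ᵇ_; _≡ᵇ_; z≤n; s≤s; NonZero; >-nonZero⁻¹)
open import Data.Nat.Divisibility using (divides; n∣n)
open import Data.Nat.DivMod using (_%_; _/_; _mod_; m%n<n; m<n⇒m%n≡m; %-distribˡ-+; m%n%n≡m%n; [m+n]%n≡m%n; [m+kn]%n≡m%n; n%n≡0; m≡m%n+[m/n]*n; m∣n⇒o%n%m≡o%m; m%[n*o]/o≡m/o%n; +-distrib-/-∣ʳ; n/n≡1; m*n/n≡m; m<n⇒m/n≡0)
import Data.Nat.Properties as ℕ
open import Data.Product.Base using (∃; ∃₂; _×_; _,_; proj₁; proj₂)
open import Data.Sum.Base using (_⊎_; inj₁; inj₂)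
open import Data.Vec.Base as Vec using (Vec; []; _∷_; toList)
import Data.Vec.Properties as Vec
open import Function.Base using (_∘_)
open import Function.Bundles using (mk⇔)
open import Level using (0ℓ)
open import Relation.Binary.Core using (Rel)
open import Relation.Binary.Definitions using (tri<; tri≈; tri>)
open import Relation.Binary.PropositionalEquality using (_≡_; _≢_; refl; sym; trans; cong; cong₂; subst; subst₂; module ≡-Reasoning)
open import Relation.Nullary using (¬_; yes; no; contradiction)
open import Relation.Nullary.Decidable using (dec-true; dec-false)
open import Defs

open Semantics

-- `Descending` has two roles. The first entry of a sublist is a word whose reversal is Descending,
-- the last entry is Descending as it stands, and a full flip leads from the second kind to the
-- first. The predicate speaks of pairs and triples of letters instead of positions in `ρ`: `≻`
-- fixes the colour of a letter once its value and the head are known, and `Cyclic` fixes the order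
-- of the values seen from the head. A Descending list is therefore determined by its head and its
-- set of values. This rigidity is why the prefix of length `j` must end its sublist as soon as the
-- prefix of length `j + 1` is Descending: its flip is then forced to be the parameter of that
-- sublist. A round of rotations raises every colour by one, and `k` rounds restore the word. So
-- among the rotations that index the blocks every letter with a value of the word comes to the
-- front exactly once; a given word can lie in one block only, which makes its occurrence unique.
-- Words are reversed because `𝒞` recurs on the last letter, which thereby becomes the head of a
-- list.

module _ {A : Set} where

  AllPairs-map-All : ∀ {P : A → Set} {R S : Rel A 0ℓ} → (∀ {x y} → P y → P x → R x y → S x y) →
                     ∀ {xs} → All P xs → AllPairs R xs → AllPairs S xs
  AllPairs-map-All f []         []         = []
  AllPairs-map-All f (px ∷ pxs) (rs ∷ rss) =
    All.zipWith (λ (py , r) → f py px r) (pxs , rs) ∷ AllPairs-map-All f pxs rss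

  AllPairs-∷ʳ⁺ : ∀ {R : Rel A 0ℓ} {xs x} → AllPairs R xs → All (λ y → R y x) xs → AllPairs R (xs ∷ʳ x)
  AllPairs-∷ʳ⁺ rs ps = AllPairs.++⁺ rs ([] ∷ []) (All.map (_∷ []) ps)

  AllPairs-++⁻ˡ : ∀ {R : Rel A 0ℓ} xs {ys} → AllPairs R (xs ++ ys) → AllPairs R xs
  AllPairs-++⁻ˡ []       _        = []
  AllPairs-++⁻ˡ (x ∷ xs) (r ∷ rs) = All.++⁻ˡ xs r ∷ AllPairs-++⁻ˡ xs rs

  AllPairs-++-∷⁻ : ∀ {R : Rel A 0ℓ} xs {y ys} → AllPairs R (xs ++ y ∷ ys) → All (λ x → R x y) xs
  AllPairs-++-∷⁻ []       _        = []
  AllPairs-++-∷⁻ (x ∷ xs) (r ∷ rs) = All.head (All.++⁻ʳ xs r) ∷ AllPairs-++-∷⁻ xs rs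

  AllPairs-reverse⁺ : ∀ {R : Rel A 0ℓ} {xs} → AllPairs R xs → AllPairs (λ x y → R y x) (reverse xs)
  AllPairs-reverse⁺ []                    = []
  AllPairs-reverse⁺ {xs = x ∷ xs} (r ∷ rs) rewrite List.unfold-reverse x xs =
    AllPairs-∷ʳ⁺ (AllPairs-reverse⁺ rs) (All-resp-↭ (↭-sym (↭-reverse xs)) r)

  -- If the heads differed, each would lie in the tail of the other list and so be related to the
  -- other head in both directions.
  sorted-unique : {R : Rel A 0ℓ} → (∀ {x y} → R x y → ¬ R y x) →
                  ∀ {xs ys} → AllPairs R xs → AllPairs R ys → xs ↭ ys → xs ≡ ys
  sorted-unique asym {[]}    {ys}    _        _        σ = sym (↭-empty-inv (↭-sym σ))
  sorted-unique asym {_ ∷ _} {[]}    _        _        σ = ↭-empty-inv σ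
  sorted-unique asym {x ∷ xs} {y ∷ ys} (r ∷ rs) (s ∷ ss) σ
    with ∈-resp-↭ σ (here refl) | ∈-resp-↭ (↭-sym σ) (here refl)
  ... | here refl | _          = cong (x ∷_) (sorted-unique asym rs ss (drop-∷ σ))
  ... | there _   | here refl  = cong (x ∷_) (sorted-unique asym rs ss (drop-∷ σ))
  ... | there x∈  | there y∈   = contradiction (All.lookup s x∈) (asym (All.lookup r y∈))

-- The cyclic order of the values

module _ {n : ℕ} where

  -- x, y, z are met in this order when the values are traversed cyclically
  -- downwards.
  data Cyclic (x y z : Fin n) : Set where
    x>y>z : y Fin.< x → z Fin.< y → Cyclic x y z
    y>z>x : z Fin.< y → x Fin.< z → Cyclic x y z
    z>x>y : x Fin.< z → y Fin.< x → Cyclic x y z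

  private variable x y z t : Fin n

  cyclic-rotate : Cyclic x y z → Cyclic y z x
  cyclic-rotate (x>y>z a b) = z>x>y a b
  cyclic-rotate (y>z>x a b) = x>y>z a b
  cyclic-rotate (z>x>y a b) = y>z>x a b

  cyclic-asym : Cyclic x y z → ¬ Cyclic x z y
  cyclic-asym (x>y>z a b) (x>y>z c d) = ℕ.<-asym b d
  cyclic-asym (x>y>z a b) (y>z>x c d) = ℕ.<-asym b c
  cyclic-asym (x>y>z a b) (z>x>y c d) = ℕ.<-asym a c
  cyclic-asym (y>z>x a b) (x>y>z c d) = ℕ.<-asym a d
  cyclic-asym (y>z>x a b) (y>z>x c d) = ℕ.<-asym a c
  cyclic-asym (y>z>x a b) (z>x>y c d) = ℕ.<-asym b d
  cyclic-asym (z>x>y a b) (x>y>z c d) = ℕ.<-asym a c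
  cyclic-asym (z>x>y a b) (y>z>x c d) = ℕ.<-asym b d
  cyclic-asym (z>x>y a b) (z>x>y c d) = ℕ.<-asym a d

  -- With `x` fixed this is the transitivity of a strict order: that in which the other values are
  -- met on the way down from `x`.
  cyclic-trans : Cyclic x y z → Cyclic x z t → Cyclic x y t
  cyclic-trans (x>y>z a b) (x>y>z c d) = x>y>z a (ℕ.<-trans d b)
  cyclic-trans (x>y>z a b) (y>z>x c d) = contradiction (ℕ.<-trans b a) (ℕ.<-asym (ℕ.<-trans d c))
  cyclic-trans (x>y>z a b) (z>x>y c d) = z>x>y c a
  cyclic-trans (y>z>x a b) (x>y>z c d) = contradiction c (ℕ.<-asym b)
  cyclic-trans (y>z>x a b) (y>z>x c d) = y>z>x (ℕ.<-trans c a) d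
  cyclic-trans (y>z>x a b) (z>x>y c d) = contradiction d (ℕ.<-asym b)
  cyclic-trans (z>x>y a b) (x>y>z c d) = contradiction c (ℕ.<-asym a)
  cyclic-trans (z>x>y a b) (y>z>x c d) = z>x>y d b
  cyclic-trans (z>x>y a b) (z>x>y c d) = contradiction d (ℕ.<-asym a)

  -- Seen from `z`, the values are met in the order `t`, `x`, `y`; transitivity there drops `x`.
  cyclic-tail : Cyclic x y z → Cyclic x z t → Cyclic y z t
  cyclic-tail p q = cyclic-rotate (cyclic-rotate (cyclic-trans (cyclic-rotate q) (cyclic-rotate (cyclic-rotate p))))

-- Colours modulo `k`

module _ {k : ℕ} .⦃ _ : NonZero k ⦄ where

  +%-cancel : ∀ a b → (a % k + b) % k ≡ (a + b) % k
  +%-cancel a b = begin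
    (a % k + b) % k            ≡⟨ %-distribˡ-+ (a % k) b k ⟩
    (a % k % k + b % k) % k    ≡⟨ cong (λ u → (u + b % k) % k) (m%n%n≡m%n a k) ⟩
    (a % k + b % k) % k        ≡⟨ %-distribˡ-+ a b k ⟨
    (a + b) % k                ∎
    where open ≡-Reasoning

  +%-cancelˡ : ∀ c s t → c ≤ k → s < k → t < k → (c + s) % k ≡ (c + t) % k → s ≡ t
  +%-cancelˡ c s t c≤k s<k t<k eq = trans (sym (undo s s<k)) (trans (cong (λ u → (u + (k ∸ c)) % k) eq) (undo t t<k))
    where
    open ≡-Reasoning
    undo : ∀ u → u < k → ((c + u) % k + (k ∸ c)) % k ≡ u
    undo u u<k = begin
      ((c + u) % k + (k ∸ c)) % k  ≡⟨ +%-cancel (c + u) (k ∸ c) ⟩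
      (c + u + (k ∸ c)) % k        ≡⟨ cong (λ z → (z + (k ∸ c)) % k) (ℕ.+-comm c u) ⟩
      (u + c + (k ∸ c)) % k        ≡⟨ cong (_% k) (ℕ.+-assoc u c (k ∸ c)) ⟩
      (u + (c + (k ∸ c))) % k      ≡⟨ cong (λ z → (u + z) % k) (ℕ.m+[n∸m]≡n c≤k) ⟩
      (u + k) % k                  ≡⟨ [m+n]%n≡m%n u k ⟩
      u % k                        ≡⟨ m<n⇒m%n≡m u<k ⟩
      u                            ∎

module _ {n k : ℕ} .⦃ _ : NonZero k ⦄ where

  ⁺-cong-% : ∀ (x : Letter n k) {s t} → s % k ≡ t % k → x ⁺ s ≡ x ⁺ t
  ⁺-cong-% (v ^^ c) {s} {t} eq = cong (v ^^_) (Fin.fromℕ<-cong _ _ (begin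
    (toℕ c + s) % k             ≡⟨ %-distribˡ-+ (toℕ c) s k ⟩
    (toℕ c % k + s % k) % k     ≡⟨ cong (λ u → (toℕ c % k + u) % k) eq ⟩
    (toℕ c % k + t % k) % k     ≡⟨ %-distribˡ-+ (toℕ c) t k ⟨
    (toℕ c + t) % k             ∎) _ _)
    where open ≡-Reasoning

  ⁺-0 : ∀ (x : Letter n k) → x ⁺ 0 ≡ x
  ⁺-0 (v ^^ c) = cong (v ^^_) (Fin.toℕ-injective (begin
    toℕ ((toℕ c + 0) mod k)  ≡⟨ Fin.toℕ-fromℕ< _ ⟩
    (toℕ c + 0) % k          ≡⟨ cong (_% k) (ℕ.+-identityʳ (toℕ c)) ⟩
    toℕ c % k                ≡⟨ m<n⇒m%n≡m (Fin.toℕ<n c) ⟩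
    toℕ c                    ∎))
    where open ≡-Reasoning

  ⁺-k : ∀ (x : Letter n k) → x ⁺ k ≡ x
  ⁺-k x = trans (⁺-cong-% x (trans (n%n≡0 k) (sym (m<n⇒m%n≡m (>-nonZero⁻¹ k))))) (⁺-0 x)

  ⁺-⁺ : ∀ (x : Letter n k) s t → x ⁺ s ⁺ t ≡ x ⁺ (s + t)
  ⁺-⁺ (v ^^ c) s t = cong (v ^^_) (Fin.fromℕ<-cong _ _ (begin
    (toℕ ((toℕ c + s) mod k) + t) % k  ≡⟨ cong (λ u → (u + t) % k) (Fin.toℕ-fromℕ< _) ⟩
    ((toℕ c + s) % k + t) % k          ≡⟨ +%-cancel (toℕ c + s) t ⟩
    (toℕ c + s + t) % k                ≡⟨ cong (_% k) (ℕ.+-assoc (toℕ c) s t) ⟩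
    (toℕ c + (s + t)) % k              ∎) _ _)
    where open ≡-Reasoning

  ⁺-sucʳ : ∀ (x : Letter n k) s → x ⁺ s ⁺ 1 ≡ x ⁺ suc s
  ⁺-sucʳ x s = trans (⁺-⁺ x s 1) (cong (x ⁺_) (ℕ.+-comm s 1))

  ⁺-comm : ∀ (x : Letter n k) s t → x ⁺ s ⁺ t ≡ x ⁺ t ⁺ s
  ⁺-comm x s t = trans (⁺-⁺ x s t) (trans (cong (x ⁺_) (ℕ.+-comm s t)) (sym (⁺-⁺ x t s)))

  ⁺1-pred : ∀ (x : Letter n k) → x ⁺ 1 ⁺ pred k ≡ x
  ⁺1-pred x = trans (⁺-⁺ x 1 (pred k)) (trans (cong (x ⁺_) (ℕ.suc-pred k)) (⁺-k x))

  -- The shift is the difference of the colours modulo `k`, with `k` added so that the truncated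
  -- subtraction is exact. Together with `⁺-injectiveʳ` it assigns each letter to exactly one of the
  -- `k` rounds of rotations.
  ⁺-surjective : ∀ (x y : Letter n k) → value x ≡ value y → ∃ λ s → s < k × x ⁺ s ≡ y
  ⁺-surjective (v ^^ c) (.v ^^ d) refl =
    s , m%n<n _ k , cong (v ^^_) (Fin.toℕ-injective (begin
      toℕ ((toℕ c + s) mod k)                ≡⟨ Fin.toℕ-fromℕ< _ ⟩
      (toℕ c + s) % k                        ≡⟨ cong (_% k) (ℕ.+-comm (toℕ c) s) ⟩
      (s + toℕ c) % k                        ≡⟨ +%-cancel (toℕ d + (k ∸ toℕ c)) (toℕ c) ⟩
      (toℕ d + (k ∸ toℕ c) + toℕ c) % k      ≡⟨ cong (_% k) (ℕ.+-assoc (toℕ d) _ (toℕ c)) ⟩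
      (toℕ d + (k ∸ toℕ c + toℕ c)) % k
        ≡⟨ cong (λ u → (toℕ d + u) % k) (ℕ.m∸n+n≡m (ℕ.<⇒≤ (Fin.toℕ<n c))) ⟩
      (toℕ d + k) % k                        ≡⟨ [m+n]%n≡m%n (toℕ d) k ⟩
      toℕ d % k                              ≡⟨ m<n⇒m%n≡m (Fin.toℕ<n d) ⟩
      toℕ d                                  ∎))
    where
    open ≡-Reasoning
    s : ℕ
    s = (toℕ d + (k ∸ toℕ c)) % k

  ⁺-injectiveʳ : ∀ (x : Letter n k) {s t} → s < k → t < k → x ⁺ s ≡ x ⁺ t → s ≡ t
  ⁺-injectiveʳ x {s} {t} s<k t<k eq = +%-cancelˡ (toℕ (colour x)) s t (ℕ.<⇒≤ (Fin.toℕ<n (colour x))) s<k t<k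
    (trans (sym (Fin.toℕ-fromℕ< _)) (trans (cong (toℕ ∘ colour) eq) (Fin.toℕ-fromℕ< _)))

-- Descending words and their rotations

module _ {n k : ℕ} .⦃ _ : NonZero k ⦄ where

  infix 4 _≻_

  private variable
    x y z t : Letter n k
    p q w : List (Letter n k)

  -- In the circular word ρ(1⁰⋯n⁰), y is one of the n - 1 letters before x.
  data _≻_ (x y : Letter n k) : Set where
    same : value y Fin.< value x → colour y ≡ colour x → x ≻ y
    next : value x Fin.< value y → colour y ≡ colour (x ⁺ 1) → x ≻ y

  -- The condition on two letters `y`, `z` that follow the head `x`. Anchoring the triple at the
  -- head expresses that less than one period is traversed; `cyclic-tail` moves the anchor to a
  -- later letter.
  record Above (x y z : Letter n k) : Set where
    constructor _,_
    field
      cyclic : Cyclic (value x) (value y) (value z)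
      order  : y ≻ z

  open Above

  -- The letters of the list are met in this order, within less than one
  -- period, when ρ(1⁰⋯n⁰) is read backwards.
  data Descending : List (Letter n k) → Set where
    []  : Descending []
    _∷_ : All (x ≻_) q → AllPairs (Above x) q → Descending (x ∷ q)

  letter-≡ : value x ≡ value y → colour x ≡ colour y → x ≡ y
  letter-≡ {_ ^^ _} refl refl = refl

  ≻⇒≢ : x ≻ y → value x ≢ value y
  ≻⇒≢ (same l _) e = ℕ.<-irrefl (cong toℕ (sym e)) l
  ≻⇒≢ (next l _) e = ℕ.<-irrefl (cong toℕ e) l

  -- `next` means that the traversal has wrapped from the least value to the greatest and raised the
  -- colour. The cyclic order allows at most one wrap between `x` and `z`, so two `next` steps are
  -- contradictory.
  ≻-trans : Cyclic (value x) (value y) (value z) → x ≻ y → y ≻ z → x ≻ z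
  ≻-trans _           (same a e) (same b f) = same (ℕ.<-trans b a) (trans f e)
  ≻-trans (x>y>z _ d) (same a e) (next b f) = contradiction b (ℕ.<-asym d)
  ≻-trans (y>z>x d _) (same a e) (next b f) = contradiction b (ℕ.<-asym d)
  ≻-trans (z>x>y d _) (same a e) (next b f) = next d (trans f (cong (λ c → (toℕ c + 1) mod k) e))
  ≻-trans (x>y>z d _) (next a e) (same b f) = contradiction d (ℕ.<-asym a)
  ≻-trans (y>z>x _ d) (next a e) (same b f) = next d (trans f e)
  ≻-trans (z>x>y _ d) (next a e) (same b f) = contradiction d (ℕ.<-asym a)
  ≻-trans (x>y>z d _) (next a e) (next b f) = contradiction d (ℕ.<-asym a)
  ≻-trans (y>z>x d _) (next a e) (next b f) = contradiction b (ℕ.<-asym d)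
  ≻-trans (z>x>y _ d) (next a e) (next b f) = contradiction d (ℕ.<-asym a)

  -- One period after `x` the backward reading arrives at `x ⁺ 1`, and `y` lies strictly between the
  -- two.
  ≻-rotate : x ≻ y → y ≻ x ⁺ 1
  ≻-rotate (same a e) = next a (cong (λ c → (toℕ c + 1) mod k) (sym e))
  ≻-rotate (next a e) = same a (sym e)

  ≻-shift : ∀ s → x ≻ y → x ⁺ s ≻ y ⁺ s
  ≻-shift         s (same a e) = same a (cong (λ c → (toℕ c + s) mod k) e)
  ≻-shift {x = x} s (next a e) =
    next a (trans (cong (λ c → (toℕ c + s) mod k) e) (cong colour (⁺-comm x 1 s)))

  ≻-determined : x ≻ y → x ≻ z → value y ≡ value z → y ≡ z
  ≻-determined (same a e) (same b f) v = letter-≡ v (trans e (sym f))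
  ≻-determined (same a e) (next b f) v = contradiction (subst (λ u → toℕ u < _) v a) (ℕ.<-asym b)
  ≻-determined (next a e) (same b f) v = contradiction (subst (λ u → _ < toℕ u) v a) (ℕ.<-asym b)
  ≻-determined (next a e) (next b f) v = letter-≡ v (trans e (sym f))

  above-trans : Above x y z → Above x z t → Above x y t
  above-trans (c , o) (c′ , o′) = cyclic-trans c c′ , ≻-trans (cyclic-tail c c′) o o′

  descending-tail : Descending (x ∷ q) → Descending q
  descending-tail {q = []}    _                = []
  descending-tail {q = y ∷ q} (_ ∷ (as ∷ ass)) =
    All.map order as ∷ AllPairs-map-All (λ _ a b → cyclic-tail (cyclic a) (cyclic b) , order b) as ass

  descending-∷ʳ : Descending q → All (_≻ z) q → AllPairs (λ x y → Cyclic (value x) (value y) (value z)) q →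
                  Descending (q ∷ʳ z)
  descending-∷ʳ []       _        _        = [] ∷ []
  descending-∷ʳ (b ∷ as) (o ∷ os) (c ∷ _) =
    All.∷ʳ⁺ b o ∷ AllPairs-∷ʳ⁺ as (All.zipWith (λ (c , o) → c , o) (c , os))

  descending-++⁻ˡ : ∀ p → Descending (p ++ q) → Descending p
  descending-++⁻ˡ []      _        = []
  descending-++⁻ˡ (x ∷ p) (b ∷ as) = All.++⁻ˡ p b ∷ AllPairs-++⁻ˡ p as

  descending-⁺ : ∀ s → Descending p → Descending (map (_⁺ s) p)
  descending-⁺ s []       = []
  descending-⁺ s (b ∷ as) =
    All.map⁺ (All.map (≻-shift s) b) ∷
    AllPairs.map⁺ (AllPairs.map (λ (c , o) → c , ≻-shift s o) as)

  map-⁺1-pred : ∀ (p : List (Letter n k)) → map (_⁺ pred k) (map (_⁺ 1) p) ≡ p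
  map-⁺1-pred p = trans (sym (List.map-∘ p)) (trans (List.map-cong ⁺1-pred p) (List.map-id p))

  descending-⁺1⁻ : Descending (map (_⁺ 1) p) → Descending p
  descending-⁺1⁻ {p} d = subst Descending (map-⁺1-pred p) (descending-⁺ (pred k) d)

  descending-distinct : Descending p → AllPairs (λ x y → value x ≢ value y) p
  descending-distinct []       = []
  descending-distinct (b ∷ as) = All.map ≻⇒≢ b ∷ AllPairs.map (≻⇒≢ ∘ order) as

  -- Seen from the head, `Cyclic` is asymmetric, so the values can be arranged in only one way; `≻`
  -- then leaves one colour for each.
  descending-unique : Descending (x ∷ p) → Descending (x ∷ q) → map value p ↭ map value q → p ≡ q
  descending-unique {x} (bp ∷ ap) (bq ∷ aq) σ = determined bp bq
    (sorted-unique cyclic-asym (AllPairs.map⁺ (AllPairs.map cyclic ap)) (AllPairs.map⁺ (AllPairs.map cyclic aq)) σ)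
    where
    determined : ∀ {p q} → All (x ≻_) p → All (x ≻_) q → map value p ≡ map value q → p ≡ q
    determined []       []       _  = refl
    determined (b ∷ bp) (c ∷ bq) eq =
      cong₂ _∷_ (≻-determined b c (List.∷-injectiveˡ eq)) (determined bp bq (List.∷-injectiveʳ eq))
    determined []       (_ ∷ _)  ()
    determined (_ ∷ _)  []       ()

  rotate : List (Letter n k) → List (Letter n k)
  rotate []      = []
  rotate (x ∷ q) = q ∷ʳ x ⁺ 1

  descending-rotate : Descending p → Descending (rotate p)
  descending-rotate []           = []
  descending-rotate d@(b ∷ as) =
    descending-∷ʳ (descending-tail d) (All.map ≻-rotate b) (AllPairs.map (cyclic-rotate ∘ cyclic) as)

  map-value-⁺ : ∀ s (p : List (Letter n k)) → map value (map (_⁺ s) p) ≡ map value p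
  map-value-⁺ s p = sym (List.map-∘ p)

  values-rotate : ∀ p → map value (rotate p) ↭ map value p
  values-rotate []      = ↭-refl
  values-rotate (x ∷ q) =
    ↭-trans (↭-reflexive (List.map-++ value q [ x ⁺ 1 ])) (↭-sym (∷↭∷ʳ (value x) (map value q)))

  length-rotate : ∀ p → length (rotate p) ≡ length p
  length-rotate []      = refl
  length-rotate (x ∷ q) = trans (List.length-++ q) (ℕ.+-comm (length q) 1)

-- The list 𝒞 on reversed words

module _ {A : Set} where

  -- The two non-memberships make this occurrence of `x` the only one, as `IsCyclicSuccessor`
  -- demands.
  NextIn : List A → A → A → Set
  NextIn xs x y = ∃₂ λ as bs → xs ≡ as ++ x ∷ y ∷ bs × x ∉ as × x ∉ y ∷ bs

  LastIn : List A → A → Set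
  LastIn xs x = ∃ λ as → xs ≡ as ∷ʳ x × x ∉ as

  ∉-++ : ∀ {x : A} xs {ys} → x ∉ xs → x ∉ ys → x ∉ xs ++ ys
  ∉-++ xs x∉xs x∉ys x∈ with ∈-++⁻ xs x∈
  ... | inj₁ x∈xs = x∉xs x∈xs
  ... | inj₂ x∈ys = x∉ys x∈ys

module _ {n k : ℕ} .⦃ _ : NonZero k ⦄ where

  private variable
    x y z t : Letter n k
    p u v w : List (Letter n k)

  rotateBy : ℕ → List (Letter n k) → List (Letter n k)
  rotateBy zero    p = p
  rotateBy (suc t) p = rotateBy t (rotate p)

  rotations : ℕ → List (Letter n k) → List (List (Letter n k))
  rotations zero    p = []
  rotations (suc t) p = p ∷ rotations t (rotate p)

  rotations-+ : ∀ s t p → rotations (s + t) p ≡ rotations s p ++ rotations t (rotateBy s p)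
  rotations-+ zero    t p = refl
  rotations-+ (suc s) t p = cong (p ∷_) (rotations-+ s t (rotate p))

  rotateBy-+ : ∀ s t p → rotateBy (s + t) p ≡ rotateBy t (rotateBy s p)
  rotateBy-+ zero    t p = refl
  rotateBy-+ (suc s) t p = rotateBy-+ s t (rotate p)

  rotateBy-∈ : ∀ {s t} p → s < t → rotateBy s p ∈ rotations t p
  rotateBy-∈ {zero}  {suc t} p _         = here refl
  rotateBy-∈ {suc s} {suc t} p (s≤s s<t) = there (rotateBy-∈ (rotate p) s<t)

  descending-rotateBy : ∀ t → Descending p → Descending (rotateBy t p)
  descending-rotateBy zero    d = d
  descending-rotateBy (suc t) d = descending-rotateBy t (descending-rotate d)

  values-rotateBy : ∀ t p → map value (rotateBy t p) ↭ map value p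
  values-rotateBy zero    p = ↭-refl
  values-rotateBy (suc t) p = ↭-trans (values-rotateBy t (rotate p)) (values-rotate p)

  length-rotateBy : ∀ t p → length (rotateBy t p) ≡ length p
  length-rotateBy zero    p = refl
  length-rotateBy (suc t) p = trans (length-rotateBy t (rotate p)) (length-rotate p)

  rotateBy-length-++ : ∀ p q → rotateBy (length p) (p ++ q) ≡ q ++ map (_⁺ 1) p
  rotateBy-length-++ []      q = sym (List.++-identityʳ q)
  rotateBy-length-++ (x ∷ p) q = begin
    rotateBy (length p) ((p ++ q) ∷ʳ x ⁺ 1)  ≡⟨ cong (rotateBy (length p)) (List.++-assoc p q _) ⟩
    rotateBy (length p) (p ++ q ∷ʳ x ⁺ 1)    ≡⟨ rotateBy-length-++ p (q ∷ʳ x ⁺ 1) ⟩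
    (q ∷ʳ x ⁺ 1) ++ map (_⁺ 1) p             ≡⟨ List.++-assoc q _ _ ⟩
    q ++ map (_⁺ 1) (x ∷ p)                  ∎
    where open ≡-Reasoning

  rotateBy-length : ∀ p → rotateBy (length p) p ≡ map (_⁺ 1) p
  rotateBy-length p = trans (cong (rotateBy (length p)) (sym (List.++-identityʳ p))) (rotateBy-length-++ p [])

  map-⁺-suc : ∀ s (p : List (Letter n k)) → map (_⁺ 1) (map (_⁺ s) p) ≡ map (_⁺ suc s) p
  map-⁺-suc s p = trans (sym (List.map-∘ p)) (List.map-cong (λ x → ⁺-sucʳ x s) p)

  map-⁺-0 : ∀ (p : List (Letter n k)) → map (_⁺ 0) p ≡ p
  map-⁺-0 p = trans (List.map-cong ⁺-0 p) (List.map-id p)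

  map-⁺-k : ∀ (p : List (Letter n k)) → map (_⁺ k) p ≡ p
  map-⁺-k p = trans (List.map-cong ⁺-k p) (List.map-id p)

  rotateBy-round : ∀ s p → rotateBy (length p) (map (_⁺ s) p) ≡ map (_⁺ suc s) p
  rotateBy-round s p = begin
    rotateBy (length p) (map (_⁺ s) p)
      ≡⟨ cong (λ l → rotateBy l (map (_⁺ s) p)) (List.length-map (_⁺ s) p) ⟨
    rotateBy (length (map (_⁺ s) p)) (map (_⁺ s) p)  ≡⟨ rotateBy-length (map (_⁺ s) p) ⟩
    map (_⁺ 1) (map (_⁺ s) p)                        ≡⟨ map-⁺-suc s p ⟩
    map (_⁺ suc s) p                                 ∎
    where open ≡-Reasoning

  rotateBy-rounds : ∀ m s p → rotateBy (m * length p) (map (_⁺ s) p) ≡ map (_⁺ (m + s)) p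
  rotateBy-rounds zero    s p = refl
  rotateBy-rounds (suc m) s p = begin
    rotateBy (length p + m * length p) (map (_⁺ s) p)             ≡⟨ rotateBy-+ (length p) (m * length p) _ ⟩
    rotateBy (m * length p) (rotateBy (length p) (map (_⁺ s) p))
      ≡⟨ cong (rotateBy (m * length p)) (rotateBy-round s p) ⟩
    rotateBy (m * length p) (map (_⁺ suc s) p)                    ≡⟨ rotateBy-rounds m (suc s) p ⟩
    map (_⁺ (m + suc s)) p                                        ≡⟨ cong (λ e → map (_⁺ e) p) (ℕ.+-suc m s) ⟩
    map (_⁺ (suc m + s)) p                                        ∎
    where open ≡-Reasoning

  rotateBy-period : ∀ p → rotateBy (k * length p) p ≡ p
  rotateBy-period p = begin
    rotateBy (k * length p) p               ≡⟨ cong (rotateBy (k * length p)) (map-⁺-0 p) ⟨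
    rotateBy (k * length p) (map (_⁺ 0) p)  ≡⟨ rotateBy-rounds k 0 p ⟩
    map (_⁺ (k + 0)) p                      ≡⟨ cong (λ e → map (_⁺ e) p) (ℕ.+-identityʳ k) ⟩
    map (_⁺ k) p                            ≡⟨ map-⁺-k p ⟩
    p                                       ∎
    where open ≡-Reasoning

  -- Rotation is periodic, so undoing one step amounts to making all the remaining steps of the
  -- period, and each of these preserves `Descending`.
  descending-rotate⁻ : ∀ x q → Descending (q ∷ʳ x ⁺ 1) → Descending (x ∷ q)
  descending-rotate⁻ x q d = subst Descending eq (descending-rotateBy (pred (k * length (x ∷ q))) d)
    where
    instance _ = ℕ.m*n≢0 k (length (x ∷ q))
    eq : rotateBy (suc (pred (k * length (x ∷ q)))) (x ∷ q) ≡ x ∷ q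
    eq = trans (cong (λ t → rotateBy t (x ∷ q)) (ℕ.suc-pred (k * length (x ∷ q)))) (rotateBy-period (x ∷ q))

  NotHead : Letter n k → List (Letter n k) → Set
  NotHead y u = ∀ q → u ≢ y ∷ q

  rotations-++-notHead : ∀ p q → All (_≢ y) p → All (NotHead y) (rotations (length p) (p ++ q))
  rotations-++-notHead []      q []         = []
  rotations-++-notHead {y} (x ∷ p) q (x≢y ∷ ne) = (λ _ eq → x≢y (List.∷-injectiveˡ eq)) ∷
    subst (All (NotHead y) ∘ rotations (length p)) (sym (List.++-assoc p q _)) (rotations-++-notHead p (q ∷ʳ x ⁺ 1) ne)

  rounds-notHead : ∀ m s p → (∀ {i} → s ≤ i → i < m + s → All (_≢ y) (map (_⁺ i) p)) →
                   All (NotHead y) (rotations (m * length p) (map (_⁺ s) p))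
  rounds-notHead zero    s p ne = []
  rounds-notHead {y} (suc m) s p ne = subst (All (NotHead y)) (sym (rotations-+ (length p) (m * length p) _))
    (All.++⁺
      (subst (All (NotHead y)) (cong₂ rotations (List.length-map (_⁺ s) p) (List.++-identityʳ _))
        (rotations-++-notHead (map (_⁺ s) p) [] (ne ℕ.≤-refl (s≤s (ℕ.m≤n+m s m)))))
      (subst (All (NotHead y) ∘ rotations (m * length p)) (sym (rotateBy-round s p))
        (rounds-notHead m (suc s) p
          (λ {i} s<i i< → ne (ℕ.<⇒≤ s<i) (subst (i <_) (ℕ.+-suc m s) i<)))))

  -- Singles out the one block of `𝒞ʳ` that can contain words with head `y`. The block itself is the
  -- `suc` in `total`; `notBefore` and `notAfter` are where the uniqueness of occurrences comes
  -- from.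
  record HeadPosition (p : List (Letter n k)) (y : Letter n k) : Set where
    field
      before after : ℕ
      remaining    : List (Letter n k)
      total        : before + suc after ≡ k * length p
      reached      : rotateBy before p ≡ y ∷ remaining
      notBefore    : All (NotHead y) (rotations before p)
      notAfter     : All (NotHead y) (rotations after (rotate (y ∷ remaining)))

  map-∈-∃++ : ∀ {v} p → v ∈ map value p → ∃ λ a → ∃ λ (z : Letter n k) → ∃ λ b → p ≡ a ++ z ∷ b × value z ≡ v
  map-∈-∃++ (z ∷ p) (here refl) = [] , z , p , refl , refl
  map-∈-∃++ (x ∷ p) (there v∈) with a , z , b , refl , e ← map-∈-∃++ p v∈ = x ∷ a , z , b , refl , e

  -- After m full rounds the list is the m-fold shift of p = a ++ z ∷ b, and
  -- y = z⁺ᵐ comes to the front after |a| further steps.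
  headPosition : ∀ p y → Descending p → value y ∈ map value p → HeadPosition p y
  headPosition p y d y∈ with map-∈-∃++ p y∈
  ... | a , z , b , refl , e with ⁺-surjective z y e
  ... | m , m<k , refl = record
    { before    = m * l + length a
    ; after     = length b + m′ * l
    ; remaining = b⁺ ++ map (_⁺ 1) a⁺
    ; total     = total
    ; reached   = reached
    ; notBefore = subst (All (NotHead y)) (sym (rotations-+ (m * l) (length a) p))
        (All.++⁺ firstRounds (subst (All (NotHead y)) (sym (cong₂ rotations (sym (List.length-map (_⁺ m) a)) rounds))
          (rotations-++-notHead a⁺ (y ∷ b⁺) a≢)))
    ; notAfter  = subst (All (NotHead y)) (sym (rotations-+ (length b) (m′ * l) _))
        (All.++⁺ (subst (All (NotHead y)) (sym (cong₂ rotations (sym (List.length-map (_⁺ m) b)) (List.++-assoc b⁺ _ _)))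
                   (rotations-++-notHead b⁺ _ b≢))
                 (subst (All (NotHead y) ∘ rotations (m′ * l)) (sym completed) lastRounds))
    }
    where
    open ≡-Reasoning
    l = length p
    m′ = k ∸ suc m
    a⁺ = map (_⁺ m) a
    b⁺ = map (_⁺ m) b

    suc-m+m′ : m′ + suc m ≡ k
    suc-m+m′ = ℕ.m∸n+n≡m m<k

    distinct : AllPairs (λ x y → value x ≢ value y) (a ++ z ∷ b)
    distinct = descending-distinct d

    values-b : ∀ a → AllPairs (λ x y → value x ≢ value y) (a ++ z ∷ b) → All (λ x → value x ≢ value z) b
    values-b []      (r ∷ _)  = All.map (λ ne eq → ne (sym eq)) r
    values-b (x ∷ a) (_ ∷ rs) = values-b a rs

    shifted≢ : ∀ i c → All (λ x → value x ≢ value z) c → All (_≢ y) (map (_⁺ i) c)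
    shifted≢ i c ne = All.map⁺ (All.map (λ ne eq → ne (cong value eq)) ne)

    a≢ = shifted≢ m a (AllPairs-++-∷⁻ a distinct)
    b≢ = shifted≢ m b (values-b a distinct)

    round≢ : ∀ {i} → i < k → i ≢ m → All (_≢ y) (map (_⁺ i) p)
    round≢ {i} i<k i≢m = subst (All (_≢ y)) (sym (List.map-++ (_⁺ i) a (z ∷ b)))
      (All.++⁺ (shifted≢ i a (AllPairs-++-∷⁻ a distinct))
        ((λ eq → i≢m (⁺-injectiveʳ z i<k m<k eq)) ∷ shifted≢ i b (values-b a distinct)))

    firstRounds : All (NotHead y) (rotations (m * l) p)
    firstRounds = subst (All (NotHead y) ∘ rotations (m * l)) (map-⁺-0 p)
      (rounds-notHead m 0 p (λ {i} _ i< →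
        let i<m = subst (i <_) (ℕ.+-identityʳ m) i< in
        round≢ (ℕ.<-trans i<m m<k) (ℕ.<⇒≢ i<m)))

    lastRounds : All (NotHead y) (rotations (m′ * l) (map (_⁺ suc m) p))
    lastRounds = rounds-notHead m′ (suc m) p (λ {i} m<i i< →
      round≢ (subst (i <_) suc-m+m′ i<) (λ eq → ℕ.<-irrefl (sym eq) m<i))

    rounds : rotateBy (m * l) p ≡ a⁺ ++ y ∷ b⁺
    rounds = begin
      rotateBy (m * l) p               ≡⟨ cong (rotateBy (m * l)) (map-⁺-0 p) ⟨
      rotateBy (m * l) (map (_⁺ 0) p)  ≡⟨ rotateBy-rounds m 0 p ⟩
      map (_⁺ (m + 0)) p               ≡⟨ cong (λ e → map (_⁺ e) p) (ℕ.+-identityʳ m) ⟩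
      map (_⁺ m) p                     ≡⟨ List.map-++ (_⁺ m) a (z ∷ b) ⟩
      a⁺ ++ y ∷ b⁺                     ∎

    reached : rotateBy (m * l + length a) p ≡ y ∷ b⁺ ++ map (_⁺ 1) a⁺
    reached = begin
      rotateBy (m * l + length a) p             ≡⟨ rotateBy-+ (m * l) (length a) p ⟩
      rotateBy (length a) (rotateBy (m * l) p)  ≡⟨ cong₂ rotateBy (sym (List.length-map (_⁺ m) a)) rounds ⟩
      rotateBy (length a⁺) (a⁺ ++ y ∷ b⁺)       ≡⟨ rotateBy-length-++ a⁺ (y ∷ b⁺) ⟩
      y ∷ b⁺ ++ map (_⁺ 1) a⁺                   ∎

    completed : rotateBy (length b) ((b⁺ ++ map (_⁺ 1) a⁺) ∷ʳ y ⁺ 1) ≡ map (_⁺ suc m) p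
    completed = begin
      rotateBy (length b) ((b⁺ ++ map (_⁺ 1) a⁺) ∷ʳ y ⁺ 1)
        ≡⟨ cong₂ rotateBy (sym (List.length-map (_⁺ m) b)) (List.++-assoc b⁺ _ _) ⟩
      rotateBy (length b⁺) (b⁺ ++ map (_⁺ 1) a⁺ ∷ʳ y ⁺ 1)     ≡⟨ rotateBy-length-++ b⁺ _ ⟩
      (map (_⁺ 1) a⁺ ∷ʳ y ⁺ 1) ++ map (_⁺ 1) b⁺               ≡⟨ List.++-assoc (map (_⁺ 1) a⁺) _ _ ⟩
      map (_⁺ 1) a⁺ ++ map (_⁺ 1) (map (_⁺ m) (z ∷ b))
        ≡⟨ cong₂ _++_ (map-⁺-suc m a) (map-⁺-suc m (z ∷ b)) ⟩
      map (_⁺ suc m) a ++ map (_⁺ suc m) (z ∷ b)              ≡⟨ List.map-++ (_⁺ suc m) a (z ∷ b) ⟨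
      map (_⁺ suc m) p                                        ∎

    total : m * l + length a + suc (length b + m′ * l) ≡ k * l
    total = begin
      m * l + length a + suc (length b + m′ * l)      ≡⟨ ℕ.+-assoc (m * l) (length a) _ ⟩
      m * l + (length a + (suc (length b) + m′ * l))  ≡⟨ cong (λ e → m * l + e) (ℕ.+-assoc (length a) _ _) ⟨
      m * l + (length a + suc (length b) + m′ * l)
        ≡⟨ cong (λ e → m * l + (e + m′ * l)) (List.length-++ a) ⟨
      m * l + suc m′ * l                              ≡⟨ ℕ.*-distribʳ-+ l m (suc m′) ⟨
      (m + suc m′) * l
        ≡⟨ cong (_* l) (trans (ℕ.+-comm m (suc m′)) (trans (sym (ℕ.+-suc m′ m)) suc-m+m′)) ⟩
      k * l                                           ∎

  -- 𝒞 on reversed words: the blocks of 𝒞(p) are indexed by the rotations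
  -- of p, and the one-letter case is subsumed.
  mutual
    𝒞ʳ : ℕ → List (Letter n k) → List (List (Letter n k))
    𝒞ʳ zero    p = [] ∷ []
    𝒞ʳ (suc j) p = concatMap (branch j) (rotations (k * suc j) p)

    branch : ℕ → List (Letter n k) → List (List (Letter n k))
    branch j []      = []
    branch j (x ∷ q) = map (x ∷_) (𝒞ʳ j q)

  -- The rotations begin with `p` unrotated, and its block begins, by induction, with its own
  -- parameter. This identifies the entry reached on entering a new block as well as the one reached
  -- by wrapping around the list.
  𝒞ʳ-first : ∀ j p → length p ≡ j → ∃ λ bs → 𝒞ʳ j p ≡ p ∷ bs
  𝒞ʳ-first zero    []      _  = [] , refl
  𝒞ʳ-first (suc j) (x ∷ q) eq with bs , e ← 𝒞ʳ-first j q (ℕ.suc-injective eq) =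
    map (x ∷_) bs ++ rest , (begin
      concatMap (branch j) (rotations (k * suc j) (x ∷ q))
        ≡⟨ cong (λ t → concatMap (branch j) (rotations t (x ∷ q))) (ℕ.suc-pred (k * suc j)) ⟨
      map (x ∷_) (𝒞ʳ j q) ++ rest
        ≡⟨ cong (λ xs → map (x ∷_) xs ++ rest) e ⟩
      (x ∷ q) ∷ map (x ∷_) bs ++ rest                                     ∎)
    where
    open ≡-Reasoning
    instance _ = ℕ.m*n≢0 k (suc j)
    rest = concatMap (branch j) (rotations (pred (k * suc j)) (q ∷ʳ x ⁺ 1))

  -- On reversed words: w′ is w with its longest Descending prefix flipped.
  data MaxFlip : (w w′ : List (Letter n k)) → Set where
    full   : Descending (reverse w) → MaxFlip w (reverse (map (_⁺ 1) w))
    deeper : ¬ Descending (reverse (y ∷ w)) → MaxFlip w v → MaxFlip (y ∷ w) (y ∷ v)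

  -- The meeting point of the two halves: the successor in the list and the result of the procedure
  -- are each shown to be a `MaxFlip` of the same word.
  maxFlip-functional : MaxFlip w u → MaxFlip w v → u ≡ v
  maxFlip-functional (full _)     (full _)     = refl
  maxFlip-functional (full d)     (deeper n _) = contradiction d n
  maxFlip-functional (deeper n _) (full d)     = contradiction d n
  maxFlip-functional (deeper _ a) (deeper _ b) = cong (_ ∷_) (maxFlip-functional a b)

  -- Shifting `reverse (y ∷ w)` by one puts `y ⁺ 1` at its end. Undoing a rotation brings `y` to the
  -- front, with the flip of `w` behind it. This list and `y ∷ q` are both Descending with the same
  -- head and values, hence equal.
  descending-complement : ∀ {y q} w → Descending (y ∷ q) → Descending (reverse (y ∷ w)) → map value w ↭ map value q →
                          reverse (map (_⁺ 1) w) ≡ q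
  descending-complement {y = y} w dq dw σ = descending-unique
    (descending-rotate⁻ y (reverse (map (_⁺ 1) w)) (subst Descending eq (descending-⁺ 1 dw))) dq
    (↭-trans (↭-trans (↭-reflexive (List.reverse-map value (map (_⁺ 1) w)))
      (↭-trans (↭-reverse _) (↭-reflexive (map-value-⁺ 1 w)))) σ)
    where
    eq : map (_⁺ 1) (reverse (y ∷ w)) ≡ reverse (map (_⁺ 1) w) ∷ʳ y ⁺ 1
    eq = trans (List.reverse-map (_⁺ 1) (y ∷ w)) (List.unfold-reverse (y ⁺ 1) (map (_⁺ 1) w))

  descending-reverse : ∀ (w : List (Letter n k)) → Descending (reverse (map (_⁺ 1) w)) → Descending (reverse w)
  descending-reverse w d = descending-⁺1⁻ (subst Descending (sym (List.reverse-map (_⁺ 1) w)) d)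

  ∉-branches : ∀ j us → All (NotHead y) us → (y ∷ w) ∉ concatMap (branch j) us
  ∉-branches j (u ∷ us) (ne ∷ nes) w∈ with ∈-++⁻ (branch j u) w∈
  ... | inj₂ w∈us = ∉-branches j us nes w∈us
  ∉-branches j ((x ∷ q) ∷ us) (ne ∷ nes) w∈ | inj₁ w∈u with _ , _ , refl ← ∈-map⁻ (x ∷_) w∈u = ne q refl

  ∉-map-∷ : ∀ {ws} → w ∉ ws → (y ∷ w) ∉ map (y ∷_) ws
  ∉-map-∷ w∉ w∈ with _ , v∈ , refl ← ∈-map⁻ (_ ∷_) w∈ = w∉ v∈

  -- The induction carries the (in)equality of the full flip with `p` because the next level needs
  -- it. Equality says that `w` ends its block, so that `y ∷ w` is flipped as a whole; inequality
  -- refutes, by `descending-complement`, that the next longer prefix is Descending, so that the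
  -- flip stays inside `w`.
  successor : ∀ j p w → length p ≡ j → Descending p → map value w ↭ map value p →
    (reverse (map (_⁺ 1) w) ≡ p × LastIn (𝒞ʳ j p) w) ⊎
    (reverse (map (_⁺ 1) w) ≢ p × ∃ λ w′ → MaxFlip w w′ × NextIn (𝒞ʳ j p) w w′)
  successor zero [] [] _ _ _ = inj₁ (refl , [] , refl , λ ())
  successor zero [] (_ ∷ _) _ _ σ with () ← ↭-empty-inv σ
  successor (suc j) (_ ∷ _) [] _ _ σ with () ← ↭-empty-inv (↭-sym σ)
  successor (suc j) p@(_ ∷ _) (y ∷ w) refl d σ = extend (successor j q w length-q (descending-tail dᵤ) σ′)
    where
    open HeadPosition (headPosition p y d (∈-resp-↭ σ (here refl))) renaming (remaining to q)
    open ≡-Reasoning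

    dᵤ : Descending (y ∷ q)
    dᵤ = subst Descending reached (descending-rotateBy before d)

    length-q : length q ≡ j
    length-q = ℕ.suc-injective (trans (cong length (sym reached)) (length-rotateBy before p))

    σ′ : map value w ↭ map value q
    σ′ = drop-∷ (↭-trans σ (↭-sym (subst (λ u → map value u ↭ map value p) reached (values-rotateBy before p))))

    A C : List (List (Letter n k))
    A = concatMap (branch j) (rotations before p)
    C = concatMap (branch j) (rotations after (rotate (y ∷ q)))

    list : 𝒞ʳ (suc j) p ≡ A ++ map (y ∷_) (𝒞ʳ j q) ++ C
    list = begin
      concatMap (branch j) (rotations (k * suc j) p)
        ≡⟨ cong (λ t → concatMap (branch j) (rotations t p)) total ⟨
      concatMap (branch j) (rotations (before + suc after) p)
        ≡⟨ cong (concatMap (branch j)) (rotations-+ before (suc after) p) ⟩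
      concatMap (branch j) (rotations before p ++ rotations (suc after) (rotateBy before p))
        ≡⟨ List.concatMap-++ (branch j) (rotations before p) _ ⟩
      A ++ concatMap (branch j) (rotations (suc after) (rotateBy before p))
        ≡⟨ cong (λ u → A ++ concatMap (branch j) (rotations (suc after) u)) reached ⟩
      A ++ map (y ∷_) (𝒞ʳ j q) ++ C                                         ∎

    y∷w∉A : (y ∷ w) ∉ A
    y∷w∉A = ∉-branches j _ notBefore

    y∷w∉C : (y ∷ w) ∉ C
    y∷w∉C = ∉-branches j _ notAfter

    flip-rotates : reverse (map (_⁺ 1) w) ≡ q → reverse (map (_⁺ 1) (y ∷ w)) ≡ rotate (y ∷ q)
    flip-rotates e = trans (List.unfold-reverse (y ⁺ 1) (map (_⁺ 1) w)) (cong (_∷ʳ y ⁺ 1) e)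

    rotate-back : rotateBy after (rotate (y ∷ q)) ≡ p
    rotate-back = begin
      rotateBy (suc after) (y ∷ q)                 ≡⟨ cong (rotateBy (suc after)) reached ⟨
      rotateBy (suc after) (rotateBy before p)     ≡⟨ rotateBy-+ before (suc after) p ⟨
      rotateBy (before + suc after) p              ≡⟨ cong (λ t → rotateBy t p) total ⟩
      rotateBy (k * suc j) p                       ≡⟨ rotateBy-period p ⟩
      p                                            ∎

    -- Otherwise y ∷ q would be reached a second time.
    rotate≢p : ∀ {s} → after ≡ suc s → rotate (y ∷ q) ≢ p
    rotate≢p {s} e eq with before ℕ.<? after
    ... | yes b<a = All.lookup notAfter (rotateBy-∈ (rotate (y ∷ q)) b<a) q (trans (cong (rotateBy before) eq) reached)
    -- Under the assumption `p` also returns to itself after `after` rotations. So `y ∷ q` is met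
    -- already `after` steps earlier, and `after` is positive.
    ... | no  b≮a = All.lookup notBefore (rotateBy-∈ p (ℕ.∸-monoʳ-< {before} {after} {0} (subst (0 <_) (sym e) (s≤s z≤n)) a≤b)) q (begin
      rotateBy (before ∸ after) p
        ≡⟨ cong (rotateBy (before ∸ after)) (trans (cong (rotateBy after) (sym eq)) rotate-back) ⟨
      rotateBy (before ∸ after) (rotateBy after p)   ≡⟨ rotateBy-+ after (before ∸ after) p ⟨
      rotateBy (after + (before ∸ after)) p          ≡⟨ cong (λ t → rotateBy t p) (ℕ.m+[n∸m]≡n a≤b) ⟩
      rotateBy before p                              ≡⟨ reached ⟩
      y ∷ q                                          ∎)
      where a≤b = ℕ.≮⇒≥ b≮a

    Goal : Set
    Goal = (reverse (map (_⁺ 1) (y ∷ w)) ≡ p × LastIn (𝒞ʳ (suc j) p) (y ∷ w)) ⊎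
           (reverse (map (_⁺ 1) (y ∷ w)) ≢ p × ∃ λ w′ → MaxFlip (y ∷ w) w′ × NextIn (𝒞ʳ (suc j) p) (y ∷ w) w′)

    -- The full flip is the parameter of the following rotation; what remains is whether that
    -- rotation still belongs to the list. The number of blocks left is abstracted as `a`, so that
    -- it can be split while `list` and `C` keep speaking of `after`.
    atBlockEnd : reverse (map (_⁺ 1) w) ≡ q → LastIn (𝒞ʳ j q) w → ∀ a → after ≡ a → Goal
    atBlockEnd e (as , eq , w∉) zero    ea = inj₁ (trans flipped closed , A ++ map (y ∷_) as , (begin
        𝒞ʳ (suc j) p                            ≡⟨ list ⟩
        A ++ map (y ∷_) (𝒞ʳ j q) ++ C
          ≡⟨ cong (λ t → A ++ map (y ∷_) (𝒞ʳ j q) ++ concatMap (branch j) (rotations t (rotate (y ∷ q)))) ea ⟩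
        A ++ map (y ∷_) (𝒞ʳ j q) ++ []          ≡⟨ cong (A ++_) (List.++-identityʳ _) ⟩
        A ++ map (y ∷_) (𝒞ʳ j q)                ≡⟨ cong (λ xs → A ++ map (y ∷_) xs) eq ⟩
        A ++ map (y ∷_) (as ∷ʳ w)               ≡⟨ cong (A ++_) (List.map-++ (y ∷_) as [ w ]) ⟩
        A ++ map (y ∷_) as ∷ʳ (y ∷ w)           ≡⟨ List.++-assoc A _ _ ⟨
        (A ++ map (y ∷_) as) ∷ʳ (y ∷ w)         ∎)
      , ∉-++ A y∷w∉A (∉-map-∷ w∉))
      where
      flipped = flip-rotates e
      -- No block is left, so this rotation completes the period and the full flip is `p`.
      closed : rotate (y ∷ q) ≡ p
      closed = trans (cong (λ t → rotateBy t (rotate (y ∷ q))) (sym ea)) rotate-back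
    atBlockEnd e (as , eq , w∉) (suc s) ea = inj₂ (
        (λ eq′ → rotate≢p ea (trans (sym flipped) eq′))
      , rotate (y ∷ q)
      , subst (MaxFlip (y ∷ w)) flipped (full (descending-reverse (y ∷ w) (subst Descending (sym flipped) (descending-rotate dᵤ))))
      , A ++ map (y ∷_) as , bs , (begin
        𝒞ʳ (suc j) p                                             ≡⟨ list ⟩
        A ++ map (y ∷_) (𝒞ʳ j q) ++ C
          ≡⟨ cong₂ (λ xs ys → A ++ map (y ∷_) xs ++ ys) eq C≡ ⟩
        A ++ map (y ∷_) (as ∷ʳ w) ++ rotate (y ∷ q) ∷ bs
          ≡⟨ cong (λ xs → A ++ xs ++ rotate (y ∷ q) ∷ bs) (List.map-++ (y ∷_) as [ w ]) ⟩
        A ++ (map (y ∷_) as ∷ʳ (y ∷ w)) ++ rotate (y ∷ q) ∷ bs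
          ≡⟨ cong (A ++_) (List.++-assoc (map (y ∷_) as) _ _) ⟩
        A ++ map (y ∷_) as ++ (y ∷ w) ∷ rotate (y ∷ q) ∷ bs      ≡⟨ List.++-assoc A _ _ ⟨
        (A ++ map (y ∷_) as) ++ (y ∷ w) ∷ rotate (y ∷ q) ∷ bs    ∎)
      , ∉-++ A y∷w∉A (∉-map-∷ w∉)
      , subst ((y ∷ w) ∉_) C≡ y∷w∉C)
      where
      flipped = flip-rotates e

      -- A block is left, and its first entry is its own parameter, the full flip of `y ∷ w`.
      branch-first : ∀ u → length u ≡ suc j → ∃ λ bs → branch j u ≡ u ∷ bs
      branch-first (x ∷ u) lu with bs , e ← 𝒞ʳ-first j u (ℕ.suc-injective lu) = map (x ∷_) bs , cong (map (x ∷_)) e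

      first : ∃ λ bs → branch j (rotate (y ∷ q)) ≡ rotate (y ∷ q) ∷ bs
      first = branch-first (rotate (y ∷ q)) (trans (length-rotate (y ∷ q)) (cong suc length-q))

      bs = proj₁ first ++ concatMap (branch j) (rotations s (rotate (rotate (y ∷ q))))

      C≡ : C ≡ rotate (y ∷ q) ∷ bs
      C≡ = trans (cong (λ t → concatMap (branch j) (rotations t (rotate (y ∷ q)))) ea)
                 (cong (_++ concatMap (branch j) (rotations s (rotate (rotate (y ∷ q))))) (proj₂ first))

    extend : (reverse (map (_⁺ 1) w) ≡ q × LastIn (𝒞ʳ j q) w) ⊎
             (reverse (map (_⁺ 1) w) ≢ q × ∃ λ w′ → MaxFlip w w′ × NextIn (𝒞ʳ j q) w w′) → Goal
    extend (inj₁ (e , lastIn)) = atBlockEnd e lastIn after refl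
    extend (inj₂ (ne , w′ , flips , as , bs , eq , w∉as , w∉bs)) = inj₂ (
        (λ eq′ → notDescending (descending-reverse (y ∷ w) (subst Descending (sym eq′) d)))
      , y ∷ w′
      , deeper notDescending flips
      , A ++ map (y ∷_) as , map (y ∷_) bs ++ C , (begin
        𝒞ʳ (suc j) p                                                     ≡⟨ list ⟩
        A ++ map (y ∷_) (𝒞ʳ j q) ++ C
          ≡⟨ cong (λ xs → A ++ map (y ∷_) xs ++ C) eq ⟩
        A ++ map (y ∷_) (as ++ w ∷ w′ ∷ bs) ++ C
          ≡⟨ cong (λ xs → A ++ xs ++ C) (List.map-++ (y ∷_) as _) ⟩
        A ++ (map (y ∷_) as ++ (y ∷ w) ∷ (y ∷ w′) ∷ map (y ∷_) bs) ++ C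
          ≡⟨ cong (A ++_) (List.++-assoc (map (y ∷_) as) _ C) ⟩
        A ++ map (y ∷_) as ++ (y ∷ w) ∷ (y ∷ w′) ∷ map (y ∷_) bs ++ C    ≡⟨ List.++-assoc A _ _ ⟨
        (A ++ map (y ∷_) as) ++ (y ∷ w) ∷ (y ∷ w′) ∷ map (y ∷_) bs ++ C  ∎)
      , ∉-++ A y∷w∉A (∉-map-∷ w∉as)
      , ∉-++ (map (y ∷_) (w′ ∷ bs)) (∉-map-∷ w∉bs) y∷w∉C)
      where
      notDescending : ¬ Descending (reverse (y ∷ w))
      notDescending d′ = ne (descending-complement w dᵤ d′ σ′)

-- From words to reversed lists

-- Reduces indices that may be negative to remainders in `ℕ`. One period suffices to lift the
-- indices that occur in `ρAt`, since they lie less than one period below zero.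
%ℕ-shift : ∀ z d x .⦃ _ : NonZero d ⦄ → z ℤ.+ + d ≡ + x → z ℤ.%ℕ d ≡ x % d
%ℕ-shift (+ m)    d x eq = trans (sym ([m+n]%n≡m%n m d)) (cong (_% d) (ℤ.+-injective eq))
%ℕ-shift -[1+ m ] d x eq with ℕ.<-cmp (suc m) d
... | tri< m<d _ _ rewrite m<n⇒m%n≡m m<d = trans (ℤ.+-injective (trans (sym (ℤ.⊖-≥ (ℕ.<⇒≤ m<d))) eq)) (sym (m<n⇒m%n≡m x<d))
  where
  x<d : x < d
  x<d = subst (_< d) (ℤ.+-injective (trans (sym (ℤ.⊖-≥ (ℕ.<⇒≤ m<d))) eq)) (ℕ.∸-monoʳ-< {d} {suc m} {0} (s≤s z≤n) (ℕ.<⇒≤ m<d))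
... | tri≈ _ e _ rewrite trans (cong (_% d) e) (n%n≡0 d) = sym (trans (cong (_% d) x≡0) (m<n⇒m%n≡m (>-nonZero⁻¹ d)))
  where
  x≡0 : x ≡ 0
  x≡0 = trans (sym (ℤ.+-injective (trans (sym (ℤ.⊖-≥ (ℕ.≤-reflexive e))) eq))) (ℕ.m≤n⇒m∸n≡0 (ℕ.≤-reflexive (sym e)))
... | tri> _ _ m>d with suc m ∸ d | ℕ.m<n⇒0<n∸m m>d | trans (sym (ℤ.⊖-< m>d)) eq
...   | suc _ | _ | ()

module _ {n k : ℕ} .⦃ _ : NonZero k ⦄ where

  reversed : ∀ {j} → Word n k j → List (Letter n k)
  reversed w = reverse (toList w)

  reversed-∷ʳ : ∀ {j} (w : Word n k j) x → reversed (w Vec.∷ʳ x) ≡ x ∷ reversed w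
  reversed-∷ʳ w x = trans (cong reverse (Vec.toList-∷ʳ x w)) (List.reverse-++ (toList w) [ x ])

  reversed-injective : ∀ {j} {w w′ : Word n k j} → reversed w ≡ reversed w′ → w ≡ w′
  reversed-injective {w = w} {w′} eq =
    trans (sym (Vec.cast-is-id refl w)) (Vec.toList-injective refl w w′ (List.reverse-injective eq))

  length-reversed : ∀ {j} (w : Word n k j) → length (reversed w) ≡ j
  length-reversed w = trans (List.length-reverse (toList w)) (Vec.length-toList w)

  reversed-tabulate : ∀ j (f : ℕ → Letter n k) → reversed (Vec.tabulate {n = j} (f ∘ toℕ)) ≡ applyDownFrom f j
  reversed-tabulate j f = trans (cong reverse (toList-tabulate j f)) (List.reverse-applyUpTo f j)
    where
    toList-tabulate : ∀ j (f : ℕ → Letter n k) → toList (Vec.tabulate {n = j} (f ∘ toℕ)) ≡ applyUpTo f j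
    toList-tabulate zero    f = refl
    toList-tabulate (suc j) f = cong (f 0 ∷_) (toList-tabulate j (f ∘ suc))

  -- The copy of the word number `d` in `ρ` carries the shift `k - 1 - d`, so the next copy is
  -- shifted by one less. At the join of the circle the shift 0 is followed by `k - 1`, and adding
  -- one gives `k`, which acts as 0.
  opposite-mod : ∀ (x : Letter n k) d →
                 x ⁺ toℕ (Fin.opposite (suc d mod k)) ⁺ 1 ≡ x ⁺ toℕ (Fin.opposite (d mod k))
  opposite-mod x d = trans (⁺-sucʳ x _) (trans (cong (λ e → x ⁺ suc e) (opposite-mod-≡ (suc d)))
                                               (trans (by-cases (ℕ.m≤n⇒m<n∨m≡n (m%n<n d k))) (cong (x ⁺_) (sym (opposite-mod-≡ d)))))
    where
    opposite-mod-≡ : ∀ d → toℕ (Fin.opposite (d mod k)) ≡ k ∸ suc (d % k)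
    opposite-mod-≡ d = trans (Fin.opposite-prop (d mod k)) (cong (λ e → k ∸ suc e) (Fin.toℕ-fromℕ< _))

    suc-% : suc d % k ≡ suc (d % k) % k
    suc-% = trans (cong (_% k) (ℕ.+-comm 1 d)) (trans (sym (+%-cancel d 1)) (cong (_% k) (ℕ.+-comm (d % k) 1)))

    by-cases : suc (d % k) < k ⊎ suc (d % k) ≡ k → x ⁺ suc (k ∸ suc (suc d % k)) ≡ x ⁺ (k ∸ suc (d % k))
    by-cases (inj₁ lt) = cong (x ⁺_) (trans (cong (λ e → suc (k ∸ suc e)) (trans suc-% (m<n⇒m%n≡m lt))) (sym (ℕ.+-∸-assoc 1 lt)))
    by-cases (inj₂ eq) = begin
      x ⁺ suc (k ∸ suc (suc d % k))
        ≡⟨ cong (λ e → x ⁺ suc (k ∸ suc e)) (trans suc-% (trans (cong (_% k) eq) (n%n≡0 k))) ⟩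
      x ⁺ suc (k ∸ 1)                ≡⟨ cong (x ⁺_) (ℕ.suc-pred k) ⟩
      x ⁺ k                          ≡⟨ ⁺-k x ⟩
      x                              ≡⟨ ⁺-0 x ⟨
      x ⁺ 0                          ≡⟨ cong (x ⁺_) (trans (cong (k ∸_) eq) (ℕ.n∸n≡0 k)) ⟨
      x ⁺ (k ∸ suc (d % k))          ∎
      where open ≡-Reasoning

  module _ {j : ℕ} (p : Word n k (suc j)) where

    private
      l m : ℕ
      l = suc j
      m = k * l

      instance
        m≢0 : NonZero m
        m≢0 = ℕ.m*n≢0 k l

    -- The letter r_{x + 1} of ρ(p).
    circular : ℕ → Letter n k
    circular x = Vec.lookup (ρ p) (x mod m)

    circular-≡ : ∀ x → circular x ≡ Vec.lookup p (x mod l) ⁺ toℕ (Fin.opposite ((x / l) mod k))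
    circular-≡ x = begin
      Vec.lookup (ρ p) (x mod m)                                       ≡⟨ cong (Vec.lookup (ρ p)) index ⟩
      Vec.lookup (ρ p) (Fin.combine a b)
        ≡⟨ Vec.lookup-concat (Vec.tabulate shifted) a b ⟩
      Vec.lookup (Vec.lookup (Vec.tabulate shifted) a) b
        ≡⟨ cong (λ u → Vec.lookup u b) (Vec.lookup∘tabulate shifted a) ⟩
      Vec.lookup (p ⁺⁺ toℕ (Fin.opposite a)) b                         ≡⟨ Vec.lookup-map b _ p ⟩
      Vec.lookup p b ⁺ toℕ (Fin.opposite a)                            ∎
      where
      open ≡-Reasoning
      a : Fin k
      a = (x / l) mod k
      b : Fin l
      b = x mod l
      shifted : Fin k → Word n k l
      shifted a = p ⁺⁺ toℕ (Fin.opposite a)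
      index : x mod m ≡ Fin.combine a b
      index = Fin.toℕ-injective (begin
        toℕ (x mod m)                    ≡⟨ Fin.toℕ-fromℕ< _ ⟩
        x % m                            ≡⟨ m≡m%n+[m/n]*n (x % m) l ⟩
        x % m % l + x % m / l * l
          ≡⟨ cong₂ (λ u v → u + v * l) (m∣n⇒o%n%m≡o%m l m x (divides k refl)) (m%[n*o]/o≡m/o%n x k l) ⟩
        x % l + x / l % k * l            ≡⟨ ℕ.+-comm (x % l) _ ⟩
        x / l % k * l + x % l            ≡⟨ cong (_+ x % l) (ℕ.*-comm (x / l % k) l) ⟩
        l * (x / l % k) + x % l
          ≡⟨ cong₂ (λ u v → l * u + v) (Fin.toℕ-fromℕ< {x / l % k} _) (Fin.toℕ-fromℕ< {x % l} _) ⟨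
        l * toℕ a + toℕ b                ≡⟨ Fin.toℕ-combine a b ⟨
        toℕ (Fin.combine a b)            ∎)

    circular-+ : ∀ x → circular (x + l) ⁺ 1 ≡ circular x
    circular-+ x = begin
      circular (x + l) ⁺ 1
        ≡⟨ cong (_⁺ 1) (circular-≡ (x + l)) ⟩
      Vec.lookup p ((x + l) mod l) ⁺ toℕ (Fin.opposite (((x + l) / l) mod k)) ⁺ 1
        ≡⟨ cong₂ (λ b d → Vec.lookup p b ⁺ toℕ (Fin.opposite (d mod k)) ⁺ 1) (Fin.fromℕ<-cong _ _ ([m+n]%n≡m%n x l) _ _) quotient ⟩
      Vec.lookup p (x mod l) ⁺ toℕ (Fin.opposite (suc (x / l) mod k)) ⁺ 1
        ≡⟨ opposite-mod (Vec.lookup p (x mod l)) (x / l) ⟩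
      Vec.lookup p (x mod l) ⁺ toℕ (Fin.opposite ((x / l) mod k))
        ≡⟨ circular-≡ x ⟨
      circular x ∎
      where
      open ≡-Reasoning
      quotient : (x + l) / l ≡ suc (x / l)
      quotient = trans (+-distrib-/-∣ʳ x {l} {l} n∣n) (trans (cong (λ u → x / l + u) (n/n≡1 l)) (ℕ.+-comm (x / l) 1))

    r-circular : ∀ i x → i ℤ.- + 1 ℤ.+ + m ≡ + x → r p i ≡ circular x
    r-circular i x eq = cong (Vec.lookup (ρ p)) (Fin.fromℕ<-cong _ _ (%ℕ-shift (i ℤ.- + 1) m x eq) _ _)

    -- In unreversed order a window is some `ρAt p i` followed by `r p i`, so `branch j` turns it
    -- into one block of `𝒞`.
    window : ℕ → List (Letter n k)
    window x = applyDownFrom (λ s → circular (x + s)) l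

    -- Sliding the window one place to the left loses `circular (x + l)` on the right and gains
    -- `circular x`, which by `circular-+` is the lost letter raised by one.
    rotate-window : ∀ x → rotate (window (suc x)) ≡ window x
    rotate-window x = begin
      applyDownFrom (λ s → circular (suc x + s)) j ∷ʳ circular (suc x + j) ⁺ 1
        ≡⟨ cong₂ _∷ʳ_ (applyDownFrom-cong (λ s → cong circular (sym (ℕ.+-suc x s))) j) first ⟩
      applyDownFrom (λ s → circular (x + suc s)) j ∷ʳ circular (x + 0)
        ≡⟨ List.applyDownFrom-∷ʳ (λ s → circular (x + s)) j ⟩
      window x                                                                  ∎
      where
      open ≡-Reasoning
      applyDownFrom-cong : ∀ {A : Set} {f g : ℕ → A} → (∀ i → f i ≡ g i) → ∀ j → applyDownFrom f j ≡ applyDownFrom g j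
      applyDownFrom-cong f≗g zero    = refl
      applyDownFrom-cong f≗g (suc j) = cong₂ _∷_ (f≗g j) (applyDownFrom-cong f≗g j)
      first : circular (suc x + j) ⁺ 1 ≡ circular (x + 0)
      first = trans (cong (λ e → circular e ⁺ 1) (sym (ℕ.+-suc x j))) (trans (circular-+ x) (cong circular (sym (ℕ.+-identityʳ x))))

    private
      -- `ρAt p (+ suc e)` starts at the 0-based position `e - j`; adding the period `m` turns this
      -- into the natural number `e + c`.
      c : ℕ
      c = m ∸ j

      j≤m : j ≤ m
      j≤m = ℕ.≤-trans (ℕ.n≤1+n j) (ℕ.m≤n*m l k)

      +c : + c ≡ + m ℤ.- + j
      +c = trans (sym (ℤ.⊖-≥ j≤m)) (sym (ℤ.m-n≡m⊖n m j))

    rotations-window : ∀ t → rotations (suc t) (window (t + c)) ≡ applyDownFrom (λ e → window (e + c)) (suc t)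
    rotations-window zero    = refl
    rotations-window (suc t) = cong (window (suc t + c) ∷_)
      (trans (cong (rotations (suc t)) (rotate-window (t + c))) (rotations-window t))

    reversed-ρAt : ∀ e → reversed (ρAt p (+ suc e)) ≡ applyDownFrom (λ s → circular (e + c + s)) j
    reversed-ρAt e = trans (cong reversed (Vec.tabulate-cong letter)) (reversed-tabulate j (λ s → circular (e + c + s)))
      where
      ring : ∀ E J S M → (+ 1 ℤ.+ E ℤ.- J ℤ.+ S) ℤ.- + 1 ℤ.+ M ≡ E ℤ.+ (M ℤ.- J) ℤ.+ S
      ring = ℤ.solve-∀

      letter : ∀ (s : Fin j) → r p (+ suc e ℤ.- + j ℤ.+ + toℕ s) ≡ circular (e + c + toℕ s)
      letter s = r-circular (+ suc e ℤ.- + j ℤ.+ + toℕ s) _ (trans (ring (+ e) (+ j) (+ toℕ s) (+ m)) (cong (λ u → + e ℤ.+ u ℤ.+ + toℕ s) (sym +c)))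

    r-window : ∀ e → r p (+ suc e) ≡ circular (e + c + j)
    r-window e = r-circular (+ suc e) _ (cong +_ (trans (cong (λ u → e + u) (sym (ℕ.m∸n+n≡m j≤m))) (sym (ℕ.+-assoc e c j))))

    -- The block `i = m` comes first in `𝒞`. Its window starts at `2m - l`, that is `2k - 1` whole
    -- copies in; modulo `k` this is copy `k - 1`, the one with shift 0.
    window-last : window (pred m + c) ≡ reversed p
    window-last = begin
      applyDownFrom (λ s → circular (pred m + c + s)) l
        ≡⟨ reversed-tabulate l (λ s → circular (pred m + c + s)) ⟨
      reversed (Vec.tabulate {n = l} (λ s → circular (pred m + c + toℕ s))) ≡⟨ cong reversed (trans (Vec.tabulate-cong letter) (Vec.tabulate∘lookup p)) ⟩
      reversed p                                                        ∎
      where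
      open ≡-Reasoning
      k-1 = pred k
      m≡ : m ≡ l + k-1 * l
      m≡ = cong (_* l) (sym (ℕ.suc-pred k))

      start : pred m + c ≡ (k-1 + k) * l
      start = begin
        pred m + (m ∸ j)                   ≡⟨ cong₂ (λ u v → pred u + (v ∸ j)) m≡ m≡ ⟩
        j + k-1 * l + (l + k-1 * l ∸ j)    ≡⟨ cong (λ e → j + k-1 * l + (e ∸ j)) (ℕ.+-suc j (k-1 * l)) ⟨
        j + k-1 * l + (j + suc (k-1 * l) ∸ j)  ≡⟨ cong (λ u → j + k-1 * l + u) (ℕ.m+n∸m≡n j _) ⟩
        j + k-1 * l + suc (k-1 * l)        ≡⟨ cong (_+ suc (k-1 * l)) (ℕ.+-comm j _) ⟩
        k-1 * l + j + suc (k-1 * l)        ≡⟨ ℕ.+-assoc (k-1 * l) j _ ⟩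
        k-1 * l + (j + suc (k-1 * l))      ≡⟨ cong (λ u → k-1 * l + u) (trans (ℕ.+-suc j _) (sym m≡)) ⟩
        k-1 * l + k * l                    ≡⟨ ℕ.*-distribʳ-+ l k-1 k ⟨
        (k-1 + k) * l                      ∎

      letter : ∀ s → circular (pred m + c + toℕ s) ≡ Vec.lookup p s
      letter s = begin
        circular (pred m + c + toℕ s)
          ≡⟨ cong circular (trans (cong (_+ toℕ s) start) (ℕ.+-comm _ (toℕ s))) ⟩
        circular x                                                       ≡⟨ circular-≡ x ⟩
        Vec.lookup p (x mod l) ⁺ toℕ (Fin.opposite ((x / l) mod k))
          ≡⟨ cong₂ (λ b o → Vec.lookup p b ⁺ o) index shift ⟩
        Vec.lookup p s ⁺ 0                                                   ≡⟨ ⁺-0 _ ⟩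
        Vec.lookup p s                                                       ∎
        where
        x = toℕ s + (k-1 + k) * l
        index : x mod l ≡ s
        index = Fin.toℕ-injective (begin
          toℕ (x mod l)  ≡⟨ Fin.toℕ-fromℕ< _ ⟩
          x % l          ≡⟨ [m+kn]%n≡m%n (toℕ s) (k-1 + k) l ⟩
          toℕ s % l      ≡⟨ m<n⇒m%n≡m (Fin.toℕ<n s) ⟩
          toℕ s          ∎)
        quotient : x / l ≡ k-1 + k
        quotient = begin
          x / l
            ≡⟨ +-distrib-/-∣ʳ (toℕ s) {(k-1 + k) * l} {l} (divides (k-1 + k) refl) ⟩
          toℕ s / l + (k-1 + k) * l / l        ≡⟨ cong₂ _+_ (m<n⇒m/n≡0 (Fin.toℕ<n s)) (m*n/n≡m (k-1 + k) l) ⟩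
          k-1 + k                              ∎
        shift : toℕ (Fin.opposite ((x / l) mod k)) ≡ 0
        shift = begin
          toℕ (Fin.opposite ((x / l) mod k))  ≡⟨ Fin.opposite-prop ((x / l) mod k) ⟩
          k ∸ suc (toℕ ((x / l) mod k))       ≡⟨ cong (λ e → k ∸ suc e) (Fin.toℕ-fromℕ< _) ⟩
          k ∸ suc (x / l % k)                 ≡⟨ cong (λ e → k ∸ suc (e % k)) quotient ⟩
          k ∸ suc ((k-1 + k) % k)             ≡⟨ cong (λ e → k ∸ suc e) ([m+n]%n≡m%n k-1 k) ⟩
          k ∸ suc (k-1 % k)
            ≡⟨ cong (λ e → k ∸ suc e) (m<n⇒m%n≡m (ℕ.≤-reflexive (ℕ.suc-pred k))) ⟩
          k ∸ suc k-1                         ≡⟨ cong (k ∸_) (ℕ.suc-pred k) ⟩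
          k ∸ k                               ≡⟨ ℕ.n∸n≡0 k ⟩
          0                                   ∎

    rotations-reversed : rotations m (reversed p) ≡ map (λ e → window (e + c)) (downFrom m)
    rotations-reversed = begin
      rotations m (reversed p)
        ≡⟨ cong₂ rotations (sym (ℕ.suc-pred m)) (sym window-last) ⟩
      rotations (suc (pred m)) (window (pred m + c))                    ≡⟨ rotations-window (pred m) ⟩
      applyDownFrom (λ e → window (e + c)) (suc (pred m))
        ≡⟨ cong (applyDownFrom (λ e → window (e + c))) (ℕ.suc-pred m) ⟩
      applyDownFrom (λ e → window (e + c)) m
        ≡⟨ List.map-downFrom (λ e → window (e + c)) m ⟨
      map (λ e → window (e + c)) (downFrom m)                           ∎
      where open ≡-Reasoning

    branch-window : ∀ e → branch j (window (e + c)) ≡ map (r p (+ suc e) ∷_) (𝒞ʳ j (reversed (ρAt p (+ suc e))))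
    branch-window e = cong₂ (λ x q → map (x ∷_) (𝒞ʳ j q)) (sym (r-window e)) (sym (reversed-ρAt e))

  -- For one letter `rotate` is the shift by one, so its `k * 1` rotations give the explicit list.
  -- For longer words the blocks agree window by window.
  reversed-𝒞 : ∀ {j} (p : Word n k (suc j)) → map reversed (𝒞 p) ≡ 𝒞ʳ (suc j) (reversed p)
  reversed-𝒞 {zero} (x ∷ []) = begin
    map reversed (map ((x ∷ []) ⁺⁺_) (upTo k))            ≡⟨ List.map-∘ (upTo k) ⟨
    map (λ s → [ x ⁺ s ]) (upTo k)                        ≡⟨ List.map-upTo (λ s → [ x ⁺ s ]) k ⟩
    applyUpTo (λ s → [ x ⁺ s ]) k                         ≡⟨ singletons k (λ s → x ⁺ s) (λ s → ⁺-sucʳ x s) ⟩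
    concatMap (branch 0) (rotations k [ x ⁺ 0 ])
      ≡⟨ cong₂ (λ t y → concatMap (branch 0) (rotations t [ y ])) (sym (ℕ.*-identityʳ k)) (⁺-0 x) ⟩
    concatMap (branch 0) (rotations (k * 1) [ x ])        ∎
    where
    open ≡-Reasoning
    singletons : ∀ t (g : ℕ → Letter n k) → (∀ s → g s ⁺ 1 ≡ g (suc s)) →
                 applyUpTo (λ s → [ g s ]) t ≡ concatMap (branch 0) (rotations t [ g 0 ])
    singletons zero    g eq = refl
    singletons (suc t) g eq = cong ([ g 0 ] ∷_) (trans (singletons t (g ∘ suc) (eq ∘ suc))
      (cong (λ y → concatMap (branch 0) (rotations t [ y ])) (sym (eq 0))))
  reversed-𝒞 {suc j} p = begin
    map reversed (𝒞 p)
      ≡⟨ List.map-concatMap reversed _ (map suc (downFrom m)) ⟩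
    concatMap (map reversed ∘ block) (map suc (downFrom m))
      ≡⟨ List.concatMap-map _ suc (downFrom m) ⟩
    concatMap (λ e → map reversed (block (suc e))) (downFrom m)
      ≡⟨ List.concatMap-cong block-≡ (downFrom m) ⟩
    concatMap (λ e → branch (suc j) (window p (e + c))) (downFrom m)
      ≡⟨ List.concatMap-map (branch (suc j)) _ (downFrom m) ⟨
    concatMap (branch (suc j)) (map (λ e → window p (e + c)) (downFrom m))
      ≡⟨ cong (concatMap (branch (suc j))) (rotations-reversed p) ⟨
    𝒞ʳ (suc (suc j)) (reversed p)                                        ∎
    where
    open ≡-Reasoning
    m c : ℕ
    m = k * suc (suc j)
    c = m ∸ suc j

    block : ℕ → List (Word n k (suc (suc j)))
    block i = map (Vec._∷ʳ r p (+ i)) (𝒞 (ρAt p (+ i)))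

    block-≡ : ∀ e → map reversed (block (suc e)) ≡ branch (suc j) (window p (e + c))
    block-≡ e = begin
      map reversed (map (Vec._∷ʳ x) ws)     ≡⟨ List.map-∘ ws ⟨
      map (λ w → reversed (w Vec.∷ʳ x)) ws  ≡⟨ List.map-cong (λ w → reversed-∷ʳ w x) ws ⟩
      map (λ w → x ∷ reversed w) ws         ≡⟨ List.map-∘ ws ⟩
      map (x ∷_) (map reversed ws)          ≡⟨ cong (map (x ∷_)) (reversed-𝒞 (ρAt p (+ suc e))) ⟩
      map (x ∷_) (𝒞ʳ (suc j) (reversed (ρAt p (+ suc e))))  ≡⟨ branch-window p e ⟨
      branch (suc j) (window p (e + c))     ∎
      where
      x = r p (+ suc e)
      ws = 𝒞 (ρAt p (+ suc e))

-- The procedure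

lookup-split : ∀ {A : Set} {m} (v : Vec A m) {xs y ys} → toList v ≡ xs ++ y ∷ ys → ∀ i → toℕ i ≡ length xs → Vec.lookup v i ≡ y
lookup-split (a ∷ v) {[]}     eq zero    _ = List.∷-injectiveˡ eq
lookup-split (a ∷ v) {_ ∷ xs} eq (suc i) e = lookup-split v (List.∷-injectiveʳ eq) i (ℕ.suc-injective e)

-- A static bound: every guarded statement counts as executed and every sequence as run to its end.
-- It depends on the syntax alone, hence is a constant for `loopBody`.
stmtCost : Stmt → ℕ
stmtCost (incr≔ e)     = 1 + expCost e
stmtCost (return e)    = 1 + expCost e
stmtCost (if e then s) = 1 + expCost e + stmtCost s
stmtCost (s ⨾ s′)      = stmtCost s + stmtCost s′

module _ {n k : ℕ} .⦃ _ : NonZero k ⦄ (π : Word (suc n) k (suc n)) where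

  exec-cost : ∀ s j x → proj₂ (exec π s j x) ≤ stmtCost s
  exec-cost (incr≔ e)     j x = ℕ.≤-refl
  exec-cost (return e)    j x = ℕ.≤-refl
  exec-cost (if e then s) j x with ⟦_⟧ π e j x
  ... | true  = ℕ.+-monoʳ-≤ (1 + expCost e) (exec-cost s j x)
  ... | false = ℕ.m≤m+n (1 + expCost e) (stmtCost s)
  exec-cost (s ⨾ s′)      j x with exec π s j x | exec-cost s j x
  ... | continue x′ , a | a≤ = ℕ.+-mono-≤ a≤ (exec-cost s′ j x′)
  ... | returned i  , a | a≤ = ℕ.≤-trans a≤ (ℕ.m≤m+n (stmtCost s) (stmtCost s′))

  execFor-cost : ∀ js s x → proj₂ (execFor π js s x) ≤ 3 + length js * (2 + stmtCost s)
  execFor-cost []       s x = ℕ.≤-refl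
  execFor-cost (j ∷ js) s x with exec π s j x | exec-cost s j x
  ... | continue x′ , a | a≤ = begin
      2 + a + proj₂ (execFor π js s x′)                   ≤⟨ ℕ.+-mono-≤ (ℕ.+-monoʳ-≤ 2 a≤) (execFor-cost js s x′) ⟩
      c + (3 + length js * c)                             ≡⟨ ℕ.+-comm c _ ⟩
      3 + length js * c + c                               ≡⟨ cong (λ u → 3 + u) (ℕ.+-comm (length js * c) c) ⟩
      3 + (c + length js * c)                             ∎
    where
    open ℕ.≤-Reasoning
    c = 2 + stmtCost s
  ... | returned i  , a | a≤ =
    ℕ.≤-trans (ℕ.+-monoʳ-≤ 2 a≤) (ℕ.≤-trans (ℕ.m≤m+n _ (length js * (2 + stmtCost s))) (ℕ.m≤n+m _ 3))

  -- Starting takes 2 operations, finishing 3, and each of the `n` iterations 2 more than its body.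
  -- Charging the fixed 5 to the factor as well gives `5 + 2 + stmtCost s`.
  run-cost : ∀ s → proj₂ (run π s) ≤ (7 + stmtCost s) * suc n
  run-cost s = begin
    2 + proj₂ (execFor π (allFin n) s 0)  ≤⟨ ℕ.+-monoʳ-≤ 2 (execFor-cost (allFin n) s 0) ⟩
    5 + length (allFin n) * c             ≡⟨ cong (λ l → 5 + l * c) (List.length-tabulate {n = n} (λ i → i)) ⟩
    5 + n * c                             ≤⟨ ℕ.+-mono-≤ (ℕ.m≤m+n 5 c) (ℕ.*-monoʳ-≤ n (ℕ.m≤n+m c 5)) ⟩
    (5 + c) + n * (5 + c)                 ≡⟨ ℕ.*-comm (suc n) (5 + c) ⟩
    (7 + stmtCost s) * suc n              ∎
    where
    open ℕ.≤-Reasoning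
    c = 2 + stmtCost s

-- One iteration decides whether the prefix extends

indicator : Bool → ℕ
indicator b = if b then 1 else 0

module _ {n : ℕ} where

  -- Holds the outcomes of both boolean tests, so that rewriting with them evaluates the conditions
  -- of the loop.
  data Comparison (v w : Fin n) : Set where
    less    : v Fin.< w → (toℕ v <ᵇ toℕ w) ≡ true → (toℕ w <ᵇ toℕ v) ≡ false → Comparison v w
    greater : w Fin.< v → (toℕ v <ᵇ toℕ w) ≡ false → (toℕ w <ᵇ toℕ v) ≡ true → Comparison v w

  compare : ∀ {v w : Fin n} → v ≢ w → Comparison v w
  compare {v} {w} v≢w with ℕ.<-cmp (toℕ v) (toℕ w)
  ... | tri< v<w _ v≯w = less v<w (dec-true (toℕ v ℕ.<? toℕ w) v<w) (dec-false (toℕ w ℕ.<? toℕ v) v≯w)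
  ... | tri≈ _ v≡w _   = contradiction (Fin.toℕ-injective v≡w) v≢w
  ... | tri> v≮w _ v>w = greater v>w (dec-false (toℕ v ℕ.<? toℕ w) v≮w) (dec-true (toℕ w ℕ.<? toℕ v) v>w)

module _ {n k : ℕ} .⦃ _ : NonZero k ⦄ where

  mismatchNext mismatchSame : (z w : Letter n k) → Bool
  mismatchNext z w = (1 <ᵇ k) ∧ not (((+ toℕ (colour w) ℤ.- + toℕ (colour z)) ℤ.%ℕ k) ≡ᵇ 1)
  mismatchSame z w = (1 <ᵇ k) ∧ not (toℕ (colour z) ≡ᵇ toℕ (colour w))

  %-difference : ∀ (z w : Letter n k) → (+ toℕ (colour w) ℤ.- + toℕ (colour z)) ℤ.%ℕ k ≡ (toℕ (colour w) + (k ∸ toℕ (colour z))) % k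
  %-difference z w = %ℕ-shift (+ d ℤ.- + c) k (d + (k ∸ c)) (begin
      + d ℤ.- + c ℤ.+ + k         ≡⟨ ℤ.+-assoc (+ d) (ℤ.- + c) (+ k) ⟩
      + d ℤ.+ (ℤ.- + c ℤ.+ + k)   ≡⟨ cong (λ u → + d ℤ.+ u) (ℤ.+-comm (ℤ.- + c) (+ k)) ⟩
      + d ℤ.+ (+ k ℤ.- + c)
        ≡⟨ cong (λ u → + d ℤ.+ u) (trans (ℤ.m-n≡m⊖n k c) (ℤ.⊖-≥ (ℕ.<⇒≤ (Fin.toℕ<n (colour z))))) ⟩
      + (d + (k ∸ c))             ∎)
    where
    open ≡-Reasoning
    c = toℕ (colour z)
    d = toℕ (colour w)

  colours-trivial : ¬ 1 < k → ∀ (c d : Fin k) → c ≡ d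
  colours-trivial k≤1 c d = Fin.toℕ-injective (trans (zero! c) (sym (zero! d)))
    where
    zero! : ∀ (c : Fin k) → toℕ c ≡ 0
    zero! c = ℕ.n<1⇒n≡0 (ℕ.<-≤-trans (Fin.toℕ<n c) (ℕ.≮⇒≥ k≤1))

  check-next : ∀ z w → (colour w ≡ colour (z ⁺ 1) × mismatchNext z w ≡ false) ⊎
                       (colour w ≢ colour (z ⁺ 1) × mismatchNext z w ≡ true)
  check-next z w with 1 ℕ.<? k
  -- With one colour every difference is 0 modulo 1 and never 1, although the colour condition
  -- holds; the guard `1 <ᵇ k` prevents this false alarm.
  ... | no k≤1 rewrite dec-false (1 ℕ.<? k) k≤1 = inj₁ (colours-trivial k≤1 _ _ , refl)
  ... | yes 1<k rewrite dec-true (1 ℕ.<? k) 1<k | %-difference z w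
    with (toℕ (colour w) + (k ∸ toℕ (colour z))) % k ℕ.≟ 1
  ...   | yes eq = inj₁ (Fin.toℕ-injective (trans d≡ (sym (Fin.toℕ-fromℕ< _))) , cong not (dec-true (_ ℕ.≟ 1) eq))
    where
    open ≡-Reasoning
    c = toℕ (colour z)
    d = toℕ (colour w)
    d≡ : d ≡ (c + 1) % k
    d≡ = begin
      d                                  ≡⟨ m<n⇒m%n≡m (Fin.toℕ<n (colour w)) ⟨
      d % k                              ≡⟨ [m+n]%n≡m%n d k ⟨
      (d + k) % k
        ≡⟨ cong (λ u → (d + u) % k) (ℕ.m∸n+n≡m (ℕ.<⇒≤ (Fin.toℕ<n (colour z)))) ⟨
      (d + (k ∸ c + c)) % k              ≡⟨ cong (_% k) (ℕ.+-assoc d (k ∸ c) c) ⟨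
      (d + (k ∸ c) + c) % k              ≡⟨ +%-cancel (d + (k ∸ c)) c ⟨
      ((d + (k ∸ c)) % k + c) % k        ≡⟨ cong (λ u → (u + c) % k) eq ⟩
      (1 + c) % k                        ≡⟨ cong (_% k) (ℕ.+-comm 1 c) ⟩
      (c + 1) % k                        ∎
  ...   | no ne = inj₂ ((λ eq → ne (result (trans (cong toℕ eq) (Fin.toℕ-fromℕ< _)))) , cong not (dec-false (_ ℕ.≟ 1) ne))
    where
    open ≡-Reasoning
    c = toℕ (colour z)
    d = toℕ (colour w)
    result : d ≡ (c + 1) % k → (d + (k ∸ c)) % k ≡ 1
    result eq = begin
      (d + (k ∸ c)) % k                  ≡⟨ cong (λ u → (u + (k ∸ c)) % k) eq ⟩
      ((c + 1) % k + (k ∸ c)) % k        ≡⟨ +%-cancel (c + 1) (k ∸ c) ⟩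
      (c + 1 + (k ∸ c)) % k              ≡⟨ cong (λ u → (u + (k ∸ c)) % k) (ℕ.+-comm c 1) ⟩
      (1 + (c + (k ∸ c))) % k
        ≡⟨ cong (λ u → (1 + u) % k) (ℕ.m+[n∸m]≡n (ℕ.<⇒≤ (Fin.toℕ<n (colour z)))) ⟩
      (1 + k) % k                        ≡⟨ [m+n]%n≡m%n 1 k ⟩
      1 % k                              ≡⟨ m<n⇒m%n≡m 1<k ⟩
      1                                  ∎

  check-same : ∀ z w → (colour w ≡ colour z × mismatchSame z w ≡ false) ⊎
                       (colour w ≢ colour z × mismatchSame z w ≡ true)
  check-same z w with 1 ℕ.<? k
  ... | no k≤1 rewrite dec-false (1 ℕ.<? k) k≤1 = inj₁ (colours-trivial k≤1 _ _ , refl)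
  ... | yes 1<k rewrite dec-true (1 ℕ.<? k) 1<k with toℕ (colour z) ℕ.≟ toℕ (colour w)
  ...   | yes eq = inj₁ (Fin.toℕ-injective (sym eq) , cong not (dec-true (_ ℕ.≟ _) eq))
  ...   | no  ne = inj₂ ((λ eq → ne (cong toℕ (sym eq))) , cong not (dec-false (_ ℕ.≟ _) ne))

  -- `x` is the head of `a ∷ʳ z`. The first iteration is apart because there the current letter is
  -- the head itself, and no triple has to be compared.
  data Starts : List (Letter n k) → Letter n k → Letter n k → Set where
    alone : ∀ {z}     → Starts [] z z
    later : ∀ {x q z} → Starts (x ∷ q) z x

  module _ (x z w : Letter n k) where

    tooLong : ℕ → Bool
    tooLong i = (i ≡ᵇ 2) ∨ ((i ≡ᵇ 1) ∧ (toℕ (value w) <ᵇ toℕ (value x)))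

    wrongNext wrongSame : Bool
    wrongNext = (1 <ᵇ k) ∧ (toℕ (value z) <ᵇ toℕ (value w)) ∧ not (((+ toℕ (colour w) ℤ.- + toℕ (colour z)) ℤ.%ℕ k) ≡ᵇ 1)
    wrongSame = (1 <ᵇ k) ∧ (toℕ (value w) <ᵇ toℕ (value z)) ∧ not (toℕ (colour z) ≡ᵇ toℕ (colour w))

    incremented : ℕ → ℕ
    incremented i = if toℕ (value z) <ᵇ toℕ (value w) then i + 1 else i

    stops : ℕ → Bool
    stops i = tooLong (incremented i) ∨ wrongNext ∨ wrongSame

  Extends : List (Letter n k) → Letter n k → Letter n k → Set
  Extends a z w = Descending ((a ∷ʳ z) ∷ʳ w)

  -- One triple is enough: the letters between `x` and `z` are related to `z` already, and
  -- `above-trans` carries this on to `w`.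
  extend⁺ : ∀ {a x z w} → Starts a z x → Descending (a ∷ʳ z) → z ≻ w → (x ≡ z ⊎ Cyclic (value x) (value z) (value w)) → Extends a z w
  extend⁺ alone _ z≻w _ = (z≻w ∷ []) ∷ ([] ∷ [])
  extend⁺ {a = x ∷ q} later (b ∷ as) z≻w (inj₁ refl) = contradiction refl (≻⇒≢ (proj₂ (All.∷ʳ⁻ b)))
  extend⁺ {a = x ∷ q} later (b ∷ as) z≻w (inj₂ c) =
    All.∷ʳ⁺ b (≻-trans c (proj₂ (All.∷ʳ⁻ b)) z≻w) ∷
    AllPairs-∷ʳ⁺ as (All.∷ʳ⁺ (All.map (λ a → above-trans a (c , z≻w)) (AllPairs-++-∷⁻ q as)) (c , z≻w))

  extend⁻ : ∀ {a x z w} → Starts a z x → Extends a z w → z ≻ w × (x ≡ z ⊎ Cyclic (value x) (value z) (value w))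
  extend⁻ alone ((b ∷ []) ∷ _) = b , inj₁ refl
  extend⁻ {a = x ∷ q} later (b ∷ as) with proj₂ (All.∷ʳ⁻ (AllPairs-++-∷⁻ (q ∷ʳ _) as))
  ... | c , o = o , inj₂ c

  ≻-greater : ∀ {z w : Letter n k} → value w Fin.< value z → z ≻ w → colour w ≡ colour z
  ≻-greater w<z (same _ e) = e
  ≻-greater w<z (next l _) = contradiction l (ℕ.<-asym w<z)

  ≻-less : ∀ {z w : Letter n k} → value z Fin.< value w → z ≻ w → colour w ≡ colour (z ⁺ 1)
  ≻-less z<w (same l _) = contradiction l (ℕ.<-asym z<w)
  ≻-less z<w (next _ e) = e

  Decision : List (Letter n k) → (x z w : Letter n k) → ℕ → Set
  Decision a x z w i =
    (Extends a z w × stops x z w i ≡ false × incremented x z w i ≡ indicator (toℕ (value x) <ᵇ toℕ (value w))) ⊎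
    (¬ Extends a z w × stops x z w i ≡ true)

  decides-alone : ∀ {z w : Letter n k} → Comparison (value z) (value w) → Decision [] z z w 0
  decides-alone {z} {w} (less z<w e f)
    rewrite e | f | ∧-zeroʳ (1 <ᵇ k) | ∨-identityʳ (mismatchNext z w) with check-next z w
  ... | inj₁ (c , m) = inj₁ (extend⁺ alone ([] ∷ []) (next z<w c) (inj₁ refl) , m , refl)
  ... | inj₂ (c , m) = inj₂ ((λ ext → c (≻-less z<w (proj₁ (extend⁻ alone ext)))) , m)
  decides-alone {z} {w} (greater w<z e f)
    rewrite e | f | ∧-zeroʳ (1 <ᵇ k) with check-same z w
  ... | inj₁ (c , m) = inj₁ (extend⁺ alone ([] ∷ []) (same w<z c) (inj₁ refl) , m , refl)
  ... | inj₂ (c , m) = inj₂ ((λ ext → c (≻-greater w<z (proj₁ (extend⁻ alone ext)))) , m)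

  -- The six orders of the values split evenly. The three cyclic ones leave the verdict to the
  -- colour test. The others are caught by `tooLong`: `x < z < w` drives `incr` to 2, while
  -- `w < x < z` and `z < w < x` make it 1 with `w` below `x`.
  decides-later : ∀ {q} {x z w : Letter n k} → Descending (x ∷ q ∷ʳ z) →
    Comparison (value x) (value z) → Comparison (value z) (value w) → Comparison (value x) (value w) →
    Decision (x ∷ q) x z w (indicator (toℕ (value x) <ᵇ toℕ (value z)))
  decides-later {q} {x} {z} {w} d (less x<z e₁ _) (less z<w e₂ _) _ rewrite e₁ | e₂ = inj₂ (notCyclic , refl)
    where
    notCyclic : ¬ Extends (x ∷ q) z w
    notCyclic ext with extend⁻ later ext
    ... | _ , inj₁ refl = ℕ.<-irrefl refl x<z
    ... | _ , inj₂ (x>y>z l _) = ℕ.<-asym l x<z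
    ... | _ , inj₂ (y>z>x l _) = ℕ.<-asym l z<w
    ... | _ , inj₂ (z>x>y _ l) = ℕ.<-asym l x<z
  decides-later {q} {x} {z} {w} d (less x<z e₁ _) (greater w<z e₂ _) (greater w<x _ f₃)
    rewrite e₁ | e₂ | f₃ = inj₂ (notCyclic , refl)
    where
    notCyclic : ¬ Extends (x ∷ q) z w
    notCyclic ext with extend⁻ later ext
    ... | _ , inj₁ refl = ℕ.<-irrefl refl x<z
    ... | _ , inj₂ (x>y>z l _) = ℕ.<-asym l x<z
    ... | _ , inj₂ (y>z>x _ l) = ℕ.<-asym l w<x
    ... | _ , inj₂ (z>x>y _ l) = ℕ.<-asym l x<z
  decides-later {q} {x} {z} {w} d (greater z<x e₁ _) (less z<w e₂ _) (greater w<x _ f₃)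
    rewrite e₁ | e₂ | f₃ = inj₂ (notCyclic , refl)
    where
    notCyclic : ¬ Extends (x ∷ q) z w
    notCyclic ext with extend⁻ later ext
    ... | _ , inj₁ refl = ℕ.<-irrefl refl z<x
    ... | _ , inj₂ (x>y>z _ l) = ℕ.<-asym l z<w
    ... | _ , inj₂ (y>z>x l _) = ℕ.<-asym l z<w
    ... | _ , inj₂ (z>x>y l _) = ℕ.<-asym l w<x
  decides-later d (greater z<x _ _) (greater w<z _ _) (less x<w _ _) =
    contradiction x<w (ℕ.<-asym (ℕ.<-trans w<z z<x))
  decides-later {q} {x} {z} {w} d (less x<z e₁ _) (greater w<z e₂ f₂) (less x<w e₃ f₃)
    rewrite e₁ | e₂ | f₂ | e₃ | f₃ | ∧-zeroʳ (1 <ᵇ k) with check-same z w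
  ... | inj₁ (c , m) = inj₁ (extend⁺ later d (same w<z c) (inj₂ (y>z>x w<z x<w)) , m , refl)
  ... | inj₂ (c , m) = inj₂ ((λ ext → c (≻-greater w<z (proj₁ (extend⁻ later ext)))) , m)
  decides-later {q} {x} {z} {w} d (greater z<x e₁ _) (less z<w e₂ f₂) (less x<w e₃ f₃)
    rewrite e₁ | e₂ | f₂ | e₃ | f₃ | ∧-zeroʳ (1 <ᵇ k) | ∨-identityʳ (mismatchNext z w) with check-next z w
  ... | inj₁ (c , m) = inj₁ (extend⁺ later d (next z<w c) (inj₂ (z>x>y x<w z<x)) , m , refl)
  ... | inj₂ (c , m) = inj₂ ((λ ext → c (≻-less z<w (proj₁ (extend⁻ later ext)))) , m)
  decides-later {q} {x} {z} {w} d (greater z<x e₁ _) (greater w<z e₂ f₂) (greater w<x e₃ _)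
    rewrite e₁ | e₂ | f₂ | e₃ | ∧-zeroʳ (1 <ᵇ k) with check-same z w
  ... | inj₁ (c , m) = inj₁ (extend⁺ later d (same w<z c) (inj₂ (x>y>z z<x w<z)) , m , refl)
  ... | inj₂ (c , m) = inj₂ ((λ ext → c (≻-greater w<z (proj₁ (extend⁻ later ext)))) , m)

  decides : ∀ {a} {x z w : Letter n k} → Starts a z x → Descending (a ∷ʳ z) → value x ≢ value w → value z ≢ value w →
    Decision a x z w (indicator (toℕ (value x) <ᵇ toℕ (value z)))
  decides {z = z} alone d _ z≢w rewrite dec-false (toℕ (value z) ℕ.<? toℕ (value z)) (ℕ.<-irrefl refl) =
    decides-alone (compare z≢w)
  decides later d@(b ∷ _) x≢w z≢w =
    decides-later d (compare (≻⇒≢ (proj₂ (All.∷ʳ⁻ b)))) (compare z≢w) (compare x≢w)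

-- The loop finds the longest Descending prefix

module _ {n k : ℕ} .⦃ _ : NonZero k ⦄ (π : Word (suc n) k (suc n)) where

  _then-continue_ : Outcome n → (ℕ → Outcome n) → Outcome n
  continue i then-continue f = f i
  returned p then-continue f = returned p

  -- `exec` without costs, written with `if_then_else_` so that the conditions remain subterms that
  -- equations can rewrite.
  outcome : Stmt → Fin n → ℕ → Outcome n
  outcome (incr≔ e)     j i = continue (⟦_⟧ π e j i)
  outcome (return e)    j i = returned (⟦_⟧ π e j i)
  outcome (if e then s) j i = if ⟦_⟧ π e j i then outcome s j i else continue i
  outcome (s ⨾ s′)      j i = outcome s j i then-continue outcome s′ j

  exec-outcome : ∀ s j i → proj₁ (exec π s j i) ≡ outcome s j i
  exec-outcome (incr≔ e)     j i = refl
  exec-outcome (return e)    j i = refl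
  exec-outcome (if e then s) j i with ⟦_⟧ π e j i
  ... | true  = exec-outcome s j i
  ... | false = refl
  exec-outcome (s ⨾ s′)      j i with exec π s j i | exec-outcome s j i
  ... | continue i′ , _ | eq rewrite sym eq = exec-outcome s′ j i′
  ... | returned p  , _ | eq rewrite sym eq = refl

  -- All three tests return the same position and none changes `incr`, so they merge into one
  -- disjunction.
  outcome-loopBody : ∀ j i → let x = Vec.lookup π zero; z = Vec.lookup π (Fin.inject₁ j); w = Vec.lookup π (suc j) in
    outcome loopBody j i ≡ (if stops x z w i then returned (Fin.inject₁ j) else continue (incremented x z w i))
  outcome-loopBody j i = trans
    (increment (toℕ (value z) <ᵇ toℕ (value w)) _)
    (checks (tooLong x z w (incremented x z w i)) (wrongNext x z w) (wrongSame x z w))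
    where
    x = Vec.lookup π zero
    z = Vec.lookup π (Fin.inject₁ j)
    w = Vec.lookup π (suc j)

    increment : ∀ b (f : ℕ → Outcome n) →
      (if b then continue (i + 1) else continue i) then-continue f ≡ f (if b then i + 1 else i)
    increment true  f = refl
    increment false f = refl

    checks : ∀ a b c {p i} →
      (if a then returned p else continue i) then-continue (λ i → (if b then returned p else continue i)
        then-continue (λ i → if c then returned p else continue i)) ≡ (if a ∨ b ∨ c then returned p else continue i)
    checks true  _     _ = refl
    checks false true  _ = refl
    checks false false _ = refl

  execFor-continue : ∀ s j js i {i′} → proj₁ (exec π s j i) ≡ continue i′ →
                     proj₁ (execFor π (j ∷ js) s i) ≡ proj₁ (execFor π js s i′)
  execFor-continue s j js i eq with exec π s j i
  execFor-continue s j js i refl | continue _ , _ = refl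

  execFor-returned : ∀ s j js i {p} → proj₁ (exec π s j i) ≡ returned p → proj₁ (execFor π (j ∷ js) s i) ≡ p
  execFor-returned s j js i eq with exec π s j i
  execFor-returned s j js i refl | returned _ , _ = refl

  record LongestPrefix (p : Fin (suc n)) : Set where
    field
      {prefix suffix} : List (Letter (suc n) k)
      split      : toList π ≡ prefix ++ suffix
      size       : length prefix ≡ suc (toℕ p)
      descending : Descending prefix
      maximal    : ∀ {y ys} → suffix ≡ y ∷ ys → ¬ Descending (prefix ∷ʳ y)

  module _ (distinct : AllPairs (λ x y → value x ≢ value y) (toList π)) where

    -- The tail of `allFin n` is not an `allFin`, hence the general `tabulate g`; the hypothesis on
    -- `g` ties the remaining indices to the part `a ∷ʳ z` already read.
    loop : ∀ {m} a z b (g : Fin m → Fin n) i → length b ≡ m → toList π ≡ (a ∷ʳ z) ++ b →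
           (∀ t → toℕ (g t) ≡ length a + toℕ t) → Descending (a ∷ʳ z) → Starts a z (Vec.lookup π zero) →
           i ≡ indicator (toℕ (value (Vec.lookup π zero)) <ᵇ toℕ (value z)) →
           LongestPrefix (proj₁ (execFor π (tabulate g) loopBody i))
    loop {zero} a z [] g i _ split _ d _ _ = record
      { split   = split
      ; size    = begin
          length (a ∷ʳ z)          ≡⟨ cong length (trans split (List.++-identityʳ _)) ⟨
          length (toList π)        ≡⟨ Vec.length-toList π ⟩
          suc n                    ≡⟨ cong suc (Fin.toℕ-fromℕ n) ⟨
          suc (toℕ (Fin.fromℕ n))  ∎
      ; descending = d
      ; maximal = λ ()
      }
      where open ≡-Reasoning
    loop {suc m} a z (w ∷ b) g i lb split gs d st refl = conclude (decides st d x≢w z≢w)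
      where
      x = Vec.lookup π zero
      j = g zero

      toℕ-j : toℕ j ≡ length a
      toℕ-j = trans (gs zero) (ℕ.+-identityʳ (length a))

      length-a∷ʳz : length (a ∷ʳ z) ≡ suc (length a)
      length-a∷ʳz = trans (List.length-++ a) (ℕ.+-comm (length a) 1)

      z≡ : Vec.lookup π (Fin.inject₁ j) ≡ z
      z≡ = lookup-split π (trans split (List.++-assoc a [ z ] (w ∷ b))) (Fin.inject₁ j) (trans (Fin.toℕ-inject₁ j) toℕ-j)

      w≡ : Vec.lookup π (suc j) ≡ w
      w≡ = lookup-split π split (suc j) (trans (cong suc toℕ-j) (sym length-a∷ʳz))

      result : proj₁ (exec π loopBody j i) ≡ (if stops x z w i then returned (Fin.inject₁ j) else continue (incremented x z w i))
      result = trans (exec-outcome loopBody j i) (trans (outcome-loopBody j i)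
        (cong₂ (λ z w → if stops x z w i then returned (Fin.inject₁ j) else continue (incremented x z w i)) z≡ w≡))

      differ : All (λ y → value y ≢ value w) (a ∷ʳ z)
      differ = AllPairs-++-∷⁻ (a ∷ʳ z) (subst (AllPairs _) split distinct)

      z≢w : value z ≢ value w
      z≢w = proj₂ (All.∷ʳ⁻ differ)

      x≢w : value x ≢ value w
      x≢w = head≢ st differ
        where
        head≢ : ∀ {a x} → Starts a z x → All (λ y → value y ≢ value w) (a ∷ʳ z) → value x ≢ value w
        head≢ alone (p ∷ _) = p
        head≢ later (p ∷ _) = p

      starts : ∀ {a x} → Starts a z x → Starts (a ∷ʳ z) w x
      starts alone = later
      starts later = later

      conclude : Decision a x z w i → LongestPrefix (proj₁ (execFor π (tabulate g) loopBody i))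
      conclude (inj₁ (d′ , stops≡ , i≡)) = subst LongestPrefix (sym (execFor-continue loopBody j (tabulate (g ∘ suc)) i continues))
        (loop (a ∷ʳ z) w b (g ∘ suc) _ (ℕ.suc-injective lb) (trans split (sym (List.++-assoc (a ∷ʳ z) [ w ] b)))
          (λ t → trans (gs (suc t)) (trans (ℕ.+-suc (length a) (toℕ t)) (cong (_+ toℕ t) (sym length-a∷ʳz))))
          d′ (starts st) i≡)
        where
        continues : proj₁ (exec π loopBody j i) ≡ continue (incremented x z w i)
        continues = trans result (cong (λ b → if b then returned (Fin.inject₁ j) else continue (incremented x z w i)) stops≡)
      conclude (inj₂ (¬d′ , stops≡)) = subst LongestPrefix (sym (execFor-returned loopBody j (tabulate (g ∘ suc)) i returns)) record
        { split      = split
        ; size       = trans length-a∷ʳz (cong suc (sym (trans (Fin.toℕ-inject₁ j) toℕ-j)))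
        ; descending = d
        ; maximal    = λ { refl → ¬d′ }
        }
        where
        returns : proj₁ (exec π loopBody j i) ≡ returned (Fin.inject₁ j)
        returns = trans result (cong (λ b → if b then returned (Fin.inject₁ j) else continue (incremented x z w i)) stops≡)

    run-longestPrefix : LongestPrefix (proj₁ (run π loopBody))
    run-longestPrefix = start π refl
      where
      start : ∀ v → v ≡ π → LongestPrefix (proj₁ (run π loopBody))
      -- Here the current letter is also the first one, so the indicator is 0, the initial value of
      -- `incr`.
      start (z ∷ v) refl = loop [] z (toList v) (λ i → i) 0 (Vec.length-toList v) refl (λ _ → refl) ([] ∷ []) alone
        (sym (cong indicator (dec-false (toℕ (value z) ℕ.<? toℕ (value z)) (ℕ.<-irrefl refl))))

-- Flipping the longest Descending prefix

module _ {A : Set} where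

  ++-injective : ∀ (as xs : List A) {bs ys} → length as ≡ length xs → as ++ bs ≡ xs ++ ys → as ≡ xs × bs ≡ ys
  ++-injective []       []       _ eq = refl , eq
  ++-injective (a ∷ as) (x ∷ xs) l eq with refl , eq′ ← List.∷-injective eq
    with refl , e ← ++-injective as xs (ℕ.suc-injective l) eq′ = refl , e

module _ {n k : ℕ} .⦃ _ : NonZero k ⦄ where

  toList-flip : ∀ {j} (i : Fin j) (p : Word n k j) a b → toList p ≡ a ++ b → length a ≡ suc (toℕ i) →
                toList (flip i p) ≡ reverse (map (_⁺ 1) a) ++ b
  toList-flip {j} i p a b split size = begin
    toList (flip i p)                                                         ≡⟨ Vec.toList-cast eq _ ⟩
    toList (Vec.reverse (Vec.take l p′ ⁺⁺ 1) Vec.++ Vec.drop l p′)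
      ≡⟨ Vec.toList-++ (Vec.reverse (Vec.take l p′ ⁺⁺ 1)) _ ⟩
    toList (Vec.reverse (Vec.take l p′ ⁺⁺ 1)) ++ toList (Vec.drop l p′)
      ≡⟨ cong (_++ toList (Vec.drop l p′)) (Vec.toList-reverse (Vec.take l p′ ⁺⁺ 1)) ⟩
    reverse (toList (Vec.take l p′ ⁺⁺ 1)) ++ toList (Vec.drop l p′)
      ≡⟨ cong (λ u → reverse u ++ toList (Vec.drop l p′)) (Vec.toList-map (_⁺ 1) (Vec.take l p′)) ⟩
    reverse (map (_⁺ 1) (toList (Vec.take l p′))) ++ toList (Vec.drop l p′)
      ≡⟨ cong₂ (λ u v → reverse (map (_⁺ 1) u) ++ v) (proj₁ parts) (proj₂ parts) ⟩
    reverse (map (_⁺ 1) a) ++ b                                               ∎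
    where
    open ≡-Reasoning
    l = suc (toℕ i)
    eq : l + (j ∸ l) ≡ j
    eq = ℕ.m+[n∸m]≡n (Fin.toℕ<n i)
    p′ : Word n k (l + (j ∸ l))
    p′ = Vec.cast (sym eq) p
    parts : toList (Vec.take l p′) ≡ a × toList (Vec.drop l p′) ≡ b
    parts = ++-injective (toList (Vec.take l p′)) a (trans (Vec.length-toList (Vec.take l p′)) (sym size)) (begin
      toList (Vec.take l p′) ++ toList (Vec.drop l p′)  ≡⟨ Vec.toList-++ (Vec.take l p′) (Vec.drop l p′) ⟨
      toList (Vec.take l p′ Vec.++ Vec.drop l p′)       ≡⟨ cong toList (Vec.take++drop≡id l p′) ⟩
      toList p′                                         ≡⟨ Vec.toList-cast (sym eq) p ⟩
      toList p                                          ≡⟨ split ⟩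
      a ++ b                                            ∎)

  -- `Descending` passes to prefixes, so a failure at `y` excludes all longer prefixes too and
  -- supplies each `deeper`.
  maxFlip-++ : ∀ {y u u′} (v : List (Letter n k)) → ¬ Descending (reverse (y ∷ u)) → MaxFlip u u′ → MaxFlip (v ++ y ∷ u) (v ++ y ∷ u′)
  maxFlip-++     []      ¬d flips = deeper ¬d flips
  maxFlip-++ {y} {u} (x ∷ v) ¬d flips = deeper
    (λ d → ¬d (descending-++⁻ˡ (reverse (y ∷ u)) (subst Descending (List.reverse-++ (x ∷ v) (y ∷ u)) d)))
    (maxFlip-++ v ¬d flips)

module _ {n k : ℕ} .⦃ _ : NonZero k ⦄ (π : Word (suc n) k (suc n)) where

  maxFlip-longestPrefix : ∀ {i} → LongestPrefix π i → MaxFlip (reversed π) (reversed (flip i π))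
  maxFlip-longestPrefix {i} record { prefix = a ; suffix = b ; split = split ; size = size ; descending = d ; maximal = maximal } =
    subst (λ u → MaxFlip u (reversed (flip i π))) (sym source) (subst (MaxFlip (reverse b ++ reverse a)) (sym target) (by-cases b refl))
    where
    source : reversed π ≡ reverse b ++ reverse a
    source = trans (cong reverse split) (List.reverse-++ a b)

    flipped = reverse (map (_⁺ 1) (reverse a))

    target : reversed (flip i π) ≡ reverse b ++ flipped
    target = trans (cong reverse (toList-flip i π a b split size)) (trans (List.reverse-++ (reverse (map (_⁺ 1) a)) b)
      (cong (λ u → reverse b ++ reverse u) (sym (List.reverse-map (_⁺ 1) a))))

    atPrefix : MaxFlip (reverse a) flipped
    atPrefix = full (subst Descending (sym (List.reverse-involutive a)) d)

    by-cases : ∀ b′ → b ≡ b′ → MaxFlip (reverse b′ ++ reverse a) (reverse b′ ++ flipped)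
    by-cases []       _    = atPrefix
    by-cases (y ∷ b′) refl = subst₂ MaxFlip (move (reverse a)) (move flipped)
      (maxFlip-++ (reverse b′) (maximal refl ∘ subst Descending reverse-∷-reverse) atPrefix)
      where
      move : ∀ (u : List (Letter (suc n) k)) → reverse b′ ++ y ∷ u ≡ reverse (y ∷ b′) ++ u
      move u = sym (trans (cong (_++ u) (List.unfold-reverse y b′)) (List.++-assoc (reverse b′) [ y ] u))
      reverse-∷-reverse : reverse (y ∷ reverse a) ≡ a ∷ʳ y
      reverse-∷-reverse = trans (List.unfold-reverse y (reverse a)) (cong (_∷ʳ y) (List.reverse-involutive a))

-- Cyclic successors in lists

module _ {A B : Set} (f : A → B) where

  map-++⁻ : ∀ xs bs {cs} → map f xs ≡ bs ++ cs → ∃₂ λ xs₁ xs₂ → xs ≡ xs₁ ++ xs₂ × map f xs₁ ≡ bs × map f xs₂ ≡ cs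
  map-++⁻ xs       []       eq = [] , xs , refl , refl , eq
  map-++⁻ (x ∷ xs) (b ∷ bs) eq with refl , eq′ ← List.∷-injective eq with xs₁ , xs₂ , refl , refl , e ← map-++⁻ xs bs eq′ =
    x ∷ xs₁ , xs₂ , refl , refl , e

toList-tabulate : ∀ {A : Set} {m} (f : Fin m → A) → toList (Vec.tabulate f) ≡ tabulate f
toList-tabulate {m = zero}  f = refl
toList-tabulate {m = suc m} f = cong (f zero ∷_) (toList-tabulate (f ∘ suc))

toℕ-cyclicSuc : ∀ {m} (i : Fin m) → suc (toℕ i) < m → toℕ (cyclicSuc i) ≡ suc (toℕ i)
toℕ-cyclicSuc {suc m} i i< = trans (Fin.toℕ-fromℕ< _) (m<n⇒m%n≡m i<)

toℕ-cyclicSuc-last : ∀ {m} (i : Fin m) → suc (toℕ i) ≡ m → toℕ (cyclicSuc i) ≡ 0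
toℕ-cyclicSuc-last {suc m} i i≡ = trans (Fin.toℕ-fromℕ< _) (trans (cong (_% suc m) i≡) (n%n≡0 (suc m)))

module _ {A : Set} where

  lookup-++-∷ : ∀ as {x : A} {bs xs} → xs ≡ as ++ x ∷ bs → ∀ i → toℕ i ≡ length as → lookup xs i ≡ x
  lookup-++-∷ []       refl zero    _ = refl
  lookup-++-∷ (a ∷ as) refl (suc i) e = lookup-++-∷ as refl i (ℕ.suc-injective e)

  lookup-unique : ∀ as {x : A} {bs xs} → xs ≡ as ++ x ∷ bs → x ∉ as → x ∉ bs → ∀ i → lookup xs i ≡ x → toℕ i ≡ length as
  lookup-unique []       refl _    _    zero    _ = refl
  lookup-unique []       refl _    x∉bs (suc i) e = contradiction (subst (_∈ _) e (∈-lookup i)) x∉bs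
  lookup-unique (a ∷ as) refl x∉as _    zero    e = contradiction (here (sym e)) x∉as
  lookup-unique (a ∷ as) refl x∉as x∉bs (suc i) e = cong suc (lookup-unique as refl (x∉as ∘ there) x∉bs i e)

  cyclicSuccessor : ∀ {xs} as {x y : A} {bs} → xs ≡ as ++ x ∷ bs → x ∉ as → x ∉ bs →
    (∀ i → toℕ i ≡ length as → lookup xs (cyclicSuc i) ≡ y) → IsCyclicSuccessor xs x y
  cyclicSuccessor {xs} as {x} {bs = bs} eq x∉as x∉bs succ = i , lookup-++-∷ as eq i toℕ-i ,
    (λ i′ e → Fin.toℕ-injective (trans (lookup-unique as eq x∉as x∉bs i′ e) (sym toℕ-i))) , succ i toℕ-i
    where
    bound : length as < length xs
    bound = subst (length as <_) (sym (trans (cong length eq) (List.length-++ as))) (ℕ.m<m+n (length as) (s≤s z≤n))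
    i : Fin (length xs)
    i = Fin.fromℕ< bound
    toℕ-i : toℕ i ≡ length as
    toℕ-i = Fin.toℕ-fromℕ< bound

  nextIn-cyclicSuccessor : ∀ {xs} {x y : A} → NextIn xs x y → IsCyclicSuccessor xs x y
  nextIn-cyclicSuccessor {xs} {x} {y} (as , bs , eq , x∉as , x∉bs) = cyclicSuccessor as eq x∉as x∉bs
    (λ i e → lookup-++-∷ (as ∷ʳ x) eq′ (cyclicSuc i) (trans (toℕ-cyclicSuc i (bound i e)) (trans (cong suc e) (sym length-∷ʳ))))
    where
    eq′ : xs ≡ (as ∷ʳ x) ++ y ∷ bs
    eq′ = trans eq (sym (List.++-assoc as [ x ] (y ∷ bs)))
    length-∷ʳ : length (as ∷ʳ x) ≡ suc (length as)
    length-∷ʳ = trans (List.length-++ as) (ℕ.+-comm (length as) 1)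
    bound : ∀ (i : Fin (length xs)) → toℕ i ≡ length as → suc (toℕ i) < length xs
    bound i e = subst (_< length xs) (trans length-∷ʳ (cong suc (sym e)))
      (subst (length (as ∷ʳ x) <_) (sym (trans (cong length eq′) (List.length-++ (as ∷ʳ x)))) (ℕ.m<m+n _ (s≤s z≤n)))

  lastIn-cyclicSuccessor : ∀ {xs ys} {x y : A} → LastIn xs x → xs ≡ y ∷ ys → IsCyclicSuccessor xs x y
  lastIn-cyclicSuccessor {xs} (as , eq , x∉as) eq′ = cyclicSuccessor as eq x∉as (λ ())
    (λ i e → lookup-++-∷ [] eq′ (cyclicSuc i) (toℕ-cyclicSuc-last i
      (trans (cong suc e) (sym (trans (cong length eq) (trans (List.length-++ as) (ℕ.+-comm (length as) 1)))))))

module _ {A B : Set} {f : A → B} (injective : ∀ {x y} → f x ≡ f y → x ≡ y) where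

  private
    ∉-map⁻ : ∀ {x xs} → f x ∉ map f xs → x ∉ xs
    ∉-map⁻ fx∉ x∈ = fx∉ (∈-map⁺ f x∈)

  nextIn-map⁻ : ∀ {xs x y} → NextIn (map f xs) (f x) y → ∃ λ y′ → f y′ ≡ y × NextIn xs x y′
  nextIn-map⁻ {xs} (as , bs , eq , x∉as , x∉bs) with map-++⁻ f xs as eq
  ... | as′ , x′ ∷ y′ ∷ bs′ , refl , refl , e with List.∷-injective e
  ... | ex , refl with refl ← injective ex = y′ , refl , as′ , bs′ , refl , ∉-map⁻ x∉as , ∉-map⁻ x∉bs

  lastIn-map⁻ : ∀ {xs x} → LastIn (map f xs) (f x) → LastIn xs x
  lastIn-map⁻ {xs} (as , eq , x∉as) with map-++⁻ f xs as eq
  ... | as′ , x′ ∷ [] , refl , refl , e with refl ← injective (List.∷-injectiveˡ e) = as′ , refl , ∉-map⁻ x∉as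

-- Coloured permutations in the list of the identity

module _ {n k : ℕ} .⦃ _ : NonZero k ⦄ where

  descending-identity : Descending (reversed (identityWord n k))
  descending-identity = decreasing (AllPairs-reverse⁺ (subst (AllPairs Increasing) (sym (toList-tabulate (λ i → i ^^ (0 mod k))))
    (AllPairs.tabulate⁺-< (λ i<j → i<j , refl))))
    where
    Increasing : Letter n k → Letter n k → Set
    Increasing x y = value x Fin.< value y × colour x ≡ colour y

    decreasing : ∀ {p} → AllPairs (λ x y → Increasing y x) p → Descending p
    decreasing []       = []
    decreasing (r ∷ rs) = All.map (λ (l , e) → same l e) r ∷
      AllPairs-map-All (λ _ (l , _) (l′ , e) → x>y>z l l′ , same l′ e) r rs

  values-word : (π : ColouredPermutation n k) → map value (toList (word π)) ≡ tabulate (values π ⟨$⟩ʳ_)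
  values-word π = trans (cong (map value) (toList-tabulate _)) (List.map-tabulate _ value)

  unique-values : (π : ColouredPermutation n k) → Unique (map value (toList (word π)))
  unique-values π = subst Unique (sym (values-word π)) (AllPairs.tabulate⁺ (λ i≢j eq →
    i≢j (trans (sym (Perm.inverseˡ (values π))) (trans (cong (values π ⟨$⟩ˡ_) eq) (Perm.inverseˡ (values π))))))

  ∈-values : (π : ColouredPermutation n k) → ∀ v → v ∈ map value (toList (word π))
  ∈-values π v = subst (v ∈_) (sym (values-word π))
    (subst (_∈ tabulate (values π ⟨$⟩ʳ_)) (Perm.inverseʳ (values π)) (∈-tabulate⁺ (values π ⟨$⟩ˡ v)))

  -- Both lists of values are duplicate-free and exhaust `Fin n`; for duplicate-free lists, equality
  -- as sets is equality as bags.
  values-↭ : (π : ColouredPermutation n k) → map value (reversed (word π)) ↭ map value (reversed (identityWord n k))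
  values-↭ π = ↭-trans (unreverse (word π)) (↭-trans (∼bag⇒↭ (unique∧set⇒bag (unique-values π) unique-allFin
    (λ {v} → mk⇔ (λ _ → subst (v ∈_) (sym values-identity) (∈-tabulate⁺ v)) (λ _ → ∈-values π v)))) (↭-sym (unreverse (identityWord n k))))
    where
    unreverse : ∀ (w : Word n k n) → map value (reversed w) ↭ map value (toList w)
    unreverse w = ↭-trans (↭-reflexive (List.reverse-map value (toList w))) (↭-reverse _)
    values-identity : map value (toList (identityWord n k)) ≡ tabulate (λ i → i)
    values-identity = trans (cong (map value) (toList-tabulate _)) (List.map-tabulate _ value)
    unique-allFin : Unique (map value (toList (identityWord n k)))
    unique-allFin = subst Unique (sym values-identity) (AllPairs.tabulate⁺ (λ i≢j → i≢j))

  -- For the last entry the full flip is `p`, which is the first entry, so the wrap-around is a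
  -- `MaxFlip` like every other step.
  successor-in-𝒞 : ∀ {j} (p w : Word n k (suc j)) → Descending (reversed p) → map value (reversed w) ↭ map value (reversed p) →
    ∃ λ w′ → MaxFlip (reversed w) (reversed w′) × IsCyclicSuccessor (𝒞 p) w w′
  successor-in-𝒞 {j} p w d σ with successor (suc j) (reversed p) (reversed w) (length-reversed p) d σ
  ... | inj₁ (e , last) = p , subst (MaxFlip (reversed w)) e (full (descending-reverse (reversed w) (subst Descending (sym e) d))) ,
        lastIn-cyclicSuccessor (lastIn-map⁻ reversed-injective (subst (λ xs → LastIn xs (reversed w)) (sym (reversed-𝒞 p)) last))
          (proj₂ first)
    where
    first : ∃ λ ys → 𝒞 p ≡ p ∷ ys
    first with bs , e ← 𝒞ʳ-first (suc j) (reversed p) (length-reversed p)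
      with [] , p′ ∷ ys , e′ , _ , e″ ← map-++⁻ reversed (𝒞 p) [] (trans (reversed-𝒞 p) e)
      = ys , trans e′ (cong (_∷ ys) (reversed-injective (List.∷-injectiveˡ e″)))
  ... | inj₂ (_ , u , flips , nextIn)
    with w′ , refl , nextIn′ ← nextIn-map⁻ reversed-injective (subst (λ xs → NextIn xs (reversed w) u) (sym (reversed-𝒞 p)) nextIn)
    = w′ , flips , nextIn-cyclicSuccessor nextIn′

theorem7 : (∀ (n k : ℕ) .⦃ _ : NonZero k ⦄ (π : ColouredPermutation (suc n) k) →
    IsCyclicSuccessor (𝒞 (identityWord (suc n) k)) (word π) (procedure π))
    × ∃ λ (C : ℕ) → ∀ (n k : ℕ) .⦃ _ : NonZero k ⦄ (π : ColouredPermutation (suc n) k) →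
    operationCount π ≤ C * suc n
theorem7 = correct , 7 + stmtCost loopBody , λ n k π → run-cost (word π) loopBody
  where
  correct : ∀ (n k : ℕ) .⦃ _ : NonZero k ⦄ (π : ColouredPermutation (suc n) k) →
            IsCyclicSuccessor (𝒞 (identityWord (suc n) k)) (word π) (procedure π)
  correct n k π with successor-in-𝒞 (identityWord (suc n) k) (word π) descending-identity (values-↭ π)
  ... | w′ , flips , isSuccessor = subst (IsCyclicSuccessor (𝒞 (identityWord (suc n) k)) (word π))
    (reversed-injective (maxFlip-functional flips (maxFlip-longestPrefix (word π)
      (run-longestPrefix (word π) (AllPairs.map⁻ (unique-values π))))))
    isSuccessor
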